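{- The edge generating series of the Fibonacci posets is $$\sum_{n\ge0}\ell(\mathcal{F}_n)x^n=\frac{x^2}{(1-x-x^2)^2},$$ and for every $n\ge0$, $\ell(\mathcal{F}_n)=\frac{nL_n-F_n}{5}$. Moreover $\ell(\mathcal{F}_n)\sim\frac n5\varphi^n$ and $i(\mathcal{F}_n)\sim\frac{n}{\sqrt5\,\varphi}$, where $\varphi=(1+\sqrt5)/2$.
   Context: Steps: $U=(1,1)$, $D=(1,-1)$, $H=(1,0)$. A Fibonacci path of length $n$ is a lattice path from $(0,0)$ to $(n,0)$ with steps $U,D,H$ that stays in the strip $0\le y\le1$ and whose $H$ steps all lie on the $x$-axis. $\mathcal{F}_n$ is the set of Fibonacci paths of length $n$, partially ordered by $\gamma_1\le\gamma_2$ iff $\gamma_1$ lies weakly below $\gamma_2$. $\ell(P)$ is the number of edges (covering pairs) of the Hasse diagram of a finite poset $P$ and $i(P)=\ell(P)/|P|$. $F_n$ are the Fibonacci numbers ($F_0=0$, $F_1=1$, $F_{n+2}=F_{n+1}+F_n$) and $L_n$ the Lucas numbers ($L_0=2$, $L_1=1$, $L_{n+2}=L_{n+1}+L_n$). $a_n\sim b_n$ means $a_n/b_n\to1$. -}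

module Defs where

open import Data.Empty.Irrelevant using (⊥-elim)
open import Data.Fin.Base using (Fin; zero; suc; inject₁; fromℕ)
import Data.Fin.Properties as Fin
open import Data.Integer.Base as ℤ using (ℤ; +_; 0ℤ; 1ℤ; -1ℤ)
import Data.Integer.Properties as ℤ
open import Algebra.Bundles using (module AbelianGroup)
open import Algebra.Properties.Group using (∙-cancelˡ)
open import Data.Integer.Tactic.RingSolver using (solve-∀)
open import Data.List.Base as List using (List; []; _∷_; _++_; length; filter; cartesianProduct; applyUpTo)
open import Data.List.Membership.Propositional using (_∈_)
open import Data.List.Membership.Propositional.Properties using (∈-map⁺; ∈-map⁻; ∈-++⁺ˡ; ∈-++⁺ʳ)
import Data.List.Relation.Unary.All as All
open import Data.List.Relation.Unary.Any using (here)
open import Data.List.Relation.Unary.AllPairs using ([]; _∷_)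
open import Data.List.Relation.Unary.Unique.Propositional using (Unique)
import Data.List.Relation.Unary.Unique.Propositional.Properties as Unique
open import Data.Nat.Base as ℕ using (ℕ; zero; suc; NonZero)
open import Data.Product.Base using (∃-syntax; _×_; _,_; proj₁; proj₂)
open import Data.Rational.Base as ℚ using (ℚ; 0ℚ; 1ℚ)
import Data.Rational.Properties as ℚ
open import Data.Sum.Base using (_⊎_)
open import Data.Vec.Base as Vec using (Vec; []; _∷_; lookup)
import Data.Vec.Properties as Vec
open import Level using (0ℓ)
open import Relation.Binary.Core using (Rel)
open import Relation.Binary.Definitions using (Decidable; DecidableEquality)
open import Relation.Binary.PropositionalEquality
open import Relation.Binary.Structures using (IsDecPartialOrder)
open import Relation.Nullary.Decidable using (yes; no; map′; True; toWitness; ¬?; _×-dec_)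
open import Relation.Nullary.Negation using (¬_)
import Relation.Binary.Construct.NonStrictToStrict as ToStrict

------------------------------------------------------------------------
-- Finite posets

record FinitePoset : Set₁ where
  infix 4 _≤_
  field
    Carrier           : Set
    _≤_               : Rel Carrier 0ℓ
    isDecPartialOrder : IsDecPartialOrder _≡_ _≤_
    elements          : List Carrier
    complete          : ∀ x → x ∈ elements
    unique            : Unique elements

  open IsDecPartialOrder isDecPartialOrder public using (_≟_; _≤?_)
  open ToStrict _≡_ _≤_ public using (_<_; <-decidable)

  -- x ⋖ y : y covers x
  infix 4 _⋖_ _<?_ _⋖?_
  _⋖_ : Rel Carrier 0ℓ
  x ⋖ y = x < y × (∀ z → ¬ (x < z × z < y))

  _<?_ : Decidable _<_
  _<?_ = <-decidable _≟_ _≤?_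

  _⋖?_ : Decidable _⋖_
  x ⋖? y = (x <? y) ×-dec
    map′ (λ none z → All.lookup none (complete z)) (λ none → All.tabulate (λ {z} _ → none z))
         (All.all? (λ z → ¬? ((x <? z) ×-dec (z <? y))) elements)

∣_∣ : FinitePoset → ℕ
∣ P ∣ = length (FinitePoset.elements P)

ℓ : FinitePoset → ℕ
ℓ P = length (filter (λ (x , y) → x ⋖? y) (cartesianProduct elements elements))
  where open FinitePoset P

i : (P : FinitePoset) .{{_ : NonZero ∣ P ∣}} → ℚ
i P = + ℓ P ℚ./ ∣ P ∣

------------------------------------------------------------------------
-- Fibonacci paths

data Step : Set where
  U D H : Step

rise : Step → ℤ
rise U = 1ℤ
rise D = -1ℤ
rise H = 0ℤ

-- Every step has horizontal extent 1, so a path of length n starting at the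
-- origin is a word of n steps; height γ k is its ordinate at abscissa k.
height : ∀ {n} → Vec Step n → Fin (suc n) → ℤ
height γ       zero    = 0ℤ
height (s ∷ γ) (suc k) = rise s ℤ.+ height γ k

record IsFibonacci {n} (γ : Vec Step n) : Set where
  field
    ends   : height γ (fromℕ n) ≡ 0ℤ
    strip  : ∀ k → 0ℤ ℤ.≤ height γ k × height γ k ℤ.≤ 1ℤ
    H-axis : ∀ k → lookup γ k ≡ H → height γ (inject₁ k) ≡ 0ℤ

-- The proof field is irrelevant, so two paths with the same steps are equal.
record FibonacciPath (n : ℕ) : Set where
  constructor fibonacciPath
  field
    steps        : Vec Step n
    .isFibonacci : IsFibonacci steps

open FibonacciPath public

-- γ₁ ⊑ γ₂ : γ₁ lies weakly below γ₂.  Both paths are linear between consecutive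
-- integer abscissae, so it is enough to compare them there.
infix 4 _⊑_
_⊑_ : ∀ {n} → Rel (FibonacciPath n) 0ℓ
γ₁ ⊑ γ₂ = ∀ k → height (steps γ₁) k ℤ.≤ height (steps γ₂) k

steps-injective : ∀ {n} {γ₁ γ₂ : FibonacciPath n} → steps γ₁ ≡ steps γ₂ → γ₁ ≡ γ₂
steps-injective refl = refl

steps-cong : ∀ {n} {γ₁ γ₂ : FibonacciPath n} → γ₁ ≡ γ₂ → steps γ₁ ≡ steps γ₂
steps-cong refl = refl

rise-injective : ∀ {s t} → rise s ≡ rise t → s ≡ t
rise-injective {U} {U} _ = refl
rise-injective {D} {D} _ = refl
rise-injective {H} {H} _ = refl

height-injective : ∀ {n} (γ₁ γ₂ : Vec Step n) → (∀ k → height γ₁ k ≡ height γ₂ k) → γ₁ ≡ γ₂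
height-injective []       []       _  = refl
height-injective (s ∷ γ₁) (t ∷ γ₂) eq
  with refl ← rise-injective {s} {t}
                (trans (sym (ℤ.+-identityʳ (rise s))) (trans (eq (suc zero)) (ℤ.+-identityʳ (rise t))))
  = cong (s ∷_) (height-injective γ₁ γ₂ λ k → ∙-cancelˡ (AbelianGroup.group ℤ.+-0-abelianGroup) (rise s) _ _ (eq (suc k)))

_≟ₛ_ : DecidableEquality Step
U ≟ₛ U = yes refl
U ≟ₛ D = no λ ()
U ≟ₛ H = no λ ()
D ≟ₛ U = no λ ()
D ≟ₛ D = yes refl
D ≟ₛ H = no λ ()
H ≟ₛ U = no λ ()
H ≟ₛ D = no λ ()
H ≟ₛ H = yes refl

⊑-isDecPartialOrder : ∀ {n} → IsDecPartialOrder {A = FibonacciPath n} _≡_ _⊑_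
⊑-isDecPartialOrder = record
  { isPartialOrder = record
    { isPreorder = record
      { isEquivalence = isEquivalence
      ; reflexive     = λ { refl k → ℤ.≤-refl }
      ; trans         = λ p q k → ℤ.≤-trans (p k) (q k)
      }
    ; antisym = λ p q → steps-injective (height-injective _ _ λ k → ℤ.≤-antisym (p k) (q k))
    }
  ; _≟_  = λ γ₁ γ₂ → map′ steps-injective (cong steps) (Vec.≡-dec _≟ₛ_ (steps γ₁) (steps γ₂))
  ; _≤?_ = λ γ₁ γ₂ → Fin.all? λ k → height (steps γ₁) k ℤ.≤? height (steps γ₂) k
  }

-- Enumeration of the Fibonacci paths, which are the words in H and UD.

H∷⁺ : ∀ {n} {γ : Vec Step n} → IsFibonacci γ → IsFibonacci (H ∷ γ)
H∷⁺ f = record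
  { ends   = trans (ℤ.+-identityˡ _) (ends f)
  ; strip  = λ { zero    → ℤ.≤-refl , ℤ.+≤+ ℕ.z≤n
               ; (suc k) → subst (λ h → 0ℤ ℤ.≤ h × h ℤ.≤ 1ℤ) (sym (ℤ.+-identityˡ _)) (strip f k) }
  ; H-axis = λ { zero    _  → refl
               ; (suc k) eq → trans (ℤ.+-identityˡ _) (H-axis f k eq) }
  }
  where open IsFibonacci

H∷⁻ : ∀ {n} {γ : Vec Step n} → IsFibonacci (H ∷ γ) → IsFibonacci γ
H∷⁻ f = record
  { ends   = trans (sym (ℤ.+-identityˡ _)) (ends f)
  ; strip  = λ k → subst (λ h → 0ℤ ℤ.≤ h × h ℤ.≤ 1ℤ) (ℤ.+-identityˡ _) (strip f (suc k))
  ; H-axis = λ k eq → trans (sym (ℤ.+-identityˡ _)) (H-axis f (suc k) eq)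
  }
  where open IsFibonacci

UD-height : ∀ h → 1ℤ ℤ.+ (-1ℤ ℤ.+ h) ≡ h
UD-height = solve-∀

UD∷⁺ : ∀ {n} {γ : Vec Step n} → IsFibonacci γ → IsFibonacci (U ∷ D ∷ γ)
UD∷⁺ f = record
  { ends   = trans (UD-height _) (ends f)
  ; strip  = λ { zero          → ℤ.≤-refl , ℤ.+≤+ ℕ.z≤n
               ; (suc zero)    → ℤ.+≤+ ℕ.z≤n , ℤ.≤-refl
               ; (suc (suc k)) → subst (λ h → 0ℤ ℤ.≤ h × h ℤ.≤ 1ℤ) (sym (UD-height _)) (strip f k) }
  ; H-axis = λ { (suc (suc k)) eq → trans (UD-height _) (H-axis f k eq) }
  }
  where open IsFibonacci

UD∷⁻ : ∀ {n} {γ : Vec Step n} → IsFibonacci (U ∷ D ∷ γ) → IsFibonacci γ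
UD∷⁻ f = record
  { ends   = trans (sym (UD-height _)) (ends f)
  ; strip  = λ k → subst (λ h → 0ℤ ℤ.≤ h × h ℤ.≤ 1ℤ) (UD-height _) (strip f (suc (suc k)))
  ; H-axis = λ k eq → trans (sym (UD-height _)) (H-axis f (suc (suc k)) eq)
  }
  where open IsFibonacci

H∷_ : ∀ {n} → FibonacciPath n → FibonacciPath (suc n)
H∷ fibonacciPath γ f = fibonacciPath (H ∷ γ) (H∷⁺ f)

UD∷_ : ∀ {n} → FibonacciPath n → FibonacciPath (suc (suc n))
UD∷ fibonacciPath γ f = fibonacciPath (U ∷ D ∷ γ) (UD∷⁺ f)

empty : FibonacciPath 0
empty = fibonacciPath [] record
  { ends = refl ; strip = λ { zero → ℤ.≤-refl , ℤ.+≤+ ℕ.z≤n } ; H-axis = λ () }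

fibonacciPaths : ∀ n → List (FibonacciPath n)
fibonacciPaths zero          = empty ∷ []
fibonacciPaths (suc zero)    = (H∷ empty) ∷ []
fibonacciPaths (suc (suc n)) =
  List.map H∷_ (fibonacciPaths (suc n)) ++ List.map UD∷_ (fibonacciPaths n)

private
  ¬D∷ : ∀ {n} {γ : Vec Step n} → ¬ IsFibonacci (D ∷ γ)
  ¬D∷ f with () ← proj₁ (IsFibonacci.strip f (suc zero))

  ¬UU∷ : ∀ {n} {γ : Vec Step n} → ¬ IsFibonacci (U ∷ U ∷ γ)
  ¬UU∷ f with ℤ.+≤+ (ℕ.s≤s ()) ← proj₂ (IsFibonacci.strip f (suc (suc zero)))

  ¬UH∷ : ∀ {n} {γ : Vec Step n} → ¬ IsFibonacci (U ∷ H ∷ γ)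
  ¬UH∷ f with () ← IsFibonacci.H-axis f (suc zero) refl

  ¬U : ¬ IsFibonacci (U ∷ [])
  ¬U f with () ← IsFibonacci.ends f

fibonacciPaths-complete : ∀ n (γ : FibonacciPath n) → γ ∈ fibonacciPaths n
fibonacciPaths-complete zero          (fibonacciPath [] _)          = here refl
fibonacciPaths-complete (suc zero)    (fibonacciPath (H ∷ []) _)    = here refl
fibonacciPaths-complete (suc zero)    (fibonacciPath (U ∷ []) f)    = ⊥-elim (¬U f)
fibonacciPaths-complete (suc n)       (fibonacciPath (D ∷ _) f)     = ⊥-elim (¬D∷ f)
fibonacciPaths-complete (suc (suc n)) (fibonacciPath (H ∷ γ) f)     =
  ∈-++⁺ˡ (∈-map⁺ H∷_ (fibonacciPaths-complete (suc n) (fibonacciPath γ (H∷⁻ f))))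
fibonacciPaths-complete (suc (suc n)) (fibonacciPath (U ∷ D ∷ γ) f) =
  ∈-++⁺ʳ (List.map H∷_ (fibonacciPaths (suc n)))
    (∈-map⁺ UD∷_ (fibonacciPaths-complete n (fibonacciPath γ (UD∷⁻ f))))
fibonacciPaths-complete (suc (suc n)) (fibonacciPath (U ∷ U ∷ _) f) = ⊥-elim (¬UU∷ f)
fibonacciPaths-complete (suc (suc n)) (fibonacciPath (U ∷ H ∷ _) f) = ⊥-elim (¬UH∷ f)

fibonacciPaths-unique : ∀ n → Unique (fibonacciPaths n)
fibonacciPaths-unique zero          = All.[] ∷ []
fibonacciPaths-unique (suc zero)    = All.[] ∷ []
fibonacciPaths-unique (suc (suc n)) = Unique.++⁺
  (Unique.map⁺ (λ {γ₁ γ₂} eq → steps-injective {γ₁ = γ₁} {γ₂} (Vec.∷-injectiveʳ (steps-cong {γ₁ = H∷ γ₁} {H∷ γ₂} eq)))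
    (fibonacciPaths-unique (suc n)))
  (Unique.map⁺ (λ {γ₁ γ₂} eq → steps-injective {γ₁ = γ₁} {γ₂}
                 (Vec.∷-injectiveʳ (Vec.∷-injectiveʳ (steps-cong {γ₁ = UD∷ γ₁} {UD∷ γ₂} eq))))
    (fibonacciPaths-unique n))
  disjoint
  where
  disjoint : ∀ {γ} → ¬ (γ ∈ List.map H∷_ (fibonacciPaths (suc n)) × γ ∈ List.map UD∷_ (fibonacciPaths n))
  disjoint (p , q) with ∈-map⁻ H∷_ p | ∈-map⁻ UD∷_ q
  ... | _ , _ , refl | _ , _ , eq with () ← Vec.∷-injectiveˡ (cong steps eq)

𝓕 : ℕ → FinitePoset
𝓕 n = record
  { Carrier           = FibonacciPath n
  ; _≤_               = _⊑_
  ; isDecPartialOrder = ⊑-isDecPartialOrder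
  ; elements          = fibonacciPaths n
  ; complete          = fibonacciPaths-complete n
  ; unique            = fibonacciPaths-unique n
  }

∣𝓕∣-nonZero : ∀ n → NonZero ∣ 𝓕 n ∣
∣𝓕∣-nonZero zero          = _
∣𝓕∣-nonZero (suc zero)    = _
∣𝓕∣-nonZero (suc (suc n)) with fibonacciPaths (suc n) | ∣𝓕∣-nonZero (suc n)
... | _ ∷ _ | _ = _

------------------------------------------------------------------------
-- Fibonacci and Lucas numbers

F : ℕ → ℕ
F 0             = 0
F 1             = 1
F (suc (suc n)) = F (suc n) ℕ.+ F n

L : ℕ → ℕ
L 0             = 2
L 1             = 1
L (suc (suc n)) = L (suc n) ℕ.+ L n

------------------------------------------------------------------------
-- Formal power series over ℤ, given by their coefficients

Series : Set
Series = ℕ → ℤ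

infixl 6 _-ₛ_
infixl 7 _*ₛ_ _/ₛ_
infixr 8 _^ₛ_

1ₛ X : Series
1ₛ zero    = 1ℤ
1ₛ (suc _) = 0ℤ
X 1 = 1ℤ
X _ = 0ℤ

_-ₛ_ _*ₛ_ : Series → Series → Series
(f -ₛ g) n = f n ℤ.- g n
(f *ₛ g) n = List.foldr ℤ._+_ 0ℤ (applyUpTo (λ k → f k ℤ.* g (n ℕ.∸ k)) (suc n))

_^ₛ_ : Series → ℕ → Series
f ^ₛ zero  = 1ₛ
f ^ₛ suc k = f *ₛ f ^ₛ k

dot : ∀ {n} → (ℕ → ℤ) → Vec ℤ n → ℤ
dot h []       = 0ℤ
dot h (a ∷ as) = h 0 ℤ.* a ℤ.+ dot (λ k → h (suc k)) as

-- Long division by a series with constant term 1: the coefficients of f / g are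
-- qₙ = fₙ - (g₁ qₙ₋₁ + ⋯ + gₙ q₀), and quotient f g n is qₙ₋₁ ∷ ⋯ ∷ q₀ ∷ [].
quotient : Series → Series → ∀ n → Vec ℤ n
quotient f g zero    = []
quotient f g (suc n) = (f n ℤ.- dot (λ k → g (suc k)) (quotient f g n)) ∷ quotient f g n

_/ₛ_ : (f g : Series) {_ : True (g 0 ℤ.≟ 1ℤ)} → Series
(f /ₛ g) n = Vec.head (quotient f g (suc n))

*ₛ-/ₛ-cancel : ∀ f g {g₀} → g *ₛ (f /ₛ g) {g₀} ≗ f
*ₛ-/ₛ-cancel f g {g₀} n = begin
  g 0 ℤ.* q n ℤ.+ rest          ≡⟨ cong (λ c → c ℤ.* q n ℤ.+ rest) (toWitness g₀) ⟩
  1ℤ ℤ.* q n ℤ.+ rest           ≡⟨ cong (ℤ._+ rest) (ℤ.*-identityˡ (q n)) ⟩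
  f n ℤ.- dot g′ qs ℤ.+ rest    ≡⟨ cong (λ d → f n ℤ.- d ℤ.+ rest) (dot-quotient g′ n) ⟩
  f n ℤ.- rest ℤ.+ rest         ≡⟨ minus-plus (f n) rest ⟩
  f n                           ∎
  where
  open ≡-Reasoning
  q = (f /ₛ g) {g₀}
  qs = quotient f g n
  g′ = λ k → g (suc k)
  rest = List.foldr ℤ._+_ 0ℤ (applyUpTo (λ k → g′ k ℤ.* q (n ℕ.∸ suc k)) n)

  minus-plus : ∀ a b → a ℤ.- b ℤ.+ b ≡ a
  minus-plus = solve-∀

  dot-quotient : ∀ h m → dot h (quotient f g m) ≡
                 List.foldr ℤ._+_ 0ℤ (applyUpTo (λ k → h k ℤ.* q (m ℕ.∸ suc k)) m)
  dot-quotient h zero    = refl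
  dot-quotient h (suc m) = cong (ℤ._+_ (h 0 ℤ.* q m)) (dot-quotient (λ k → h (suc k)) m)

------------------------------------------------------------------------
-- The ordered field ℚ(√5) ⊆ ℝ, which contains every real number needed here.

infix 5 _+_√5
record ℚ√5 : Set where
  constructor _+_√5
  field
    a b : ℚ

infixl 6 _+₅_ _-₅_
infixl 7 _*₅_ _/₅_
infixr 8 _^₅_
infixl 9 _⁻¹₅
infix  4 _<₅_

fromℚ : ℚ → ℚ√5
fromℚ p = p + 0ℚ √5

fromℕ₅ : ℕ → ℚ√5
fromℕ₅ n = fromℚ (+ n ℚ./ 1)

√5 : ℚ√5
√5 = 0ℚ + 1ℚ √5

_+₅_ _-₅_ _*₅_ : ℚ√5 → ℚ√5 → ℚ√5
(a + b √5) +₅ (c + d √5) = (a ℚ.+ c) + (b ℚ.+ d) √5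
(a + b √5) -₅ (c + d √5) = (a ℚ.- c) + (b ℚ.- d) √5
(a + b √5) *₅ (c + d √5) = (a ℚ.* c ℚ.+ + 5 ℚ./ 1 ℚ.* (b ℚ.* d)) + (a ℚ.* d ℚ.+ b ℚ.* c) √5

_^₅_ : ℚ√5 → ℕ → ℚ√5
x ^₅ zero  = fromℕ₅ 1
x ^₅ suc n = x *₅ x ^₅ n

recip : ℚ → ℚ
recip p with p ℚ.≟ 0ℚ
... | yes _   = 0ℚ
... | no p≢0 = (ℚ.1/ p) {{ℚ.≢-nonZero p≢0}}

-- (a + b√5)⁻¹ = (a - b√5) / (a² - 5b²), where a² - 5b² vanishes only for a = b = 0
-- because √5 is irrational.  Division by zero yields zero.
_⁻¹₅ : ℚ√5 → ℚ√5
(a + b √5) ⁻¹₅ = (a ℚ.* r) + (ℚ.- b ℚ.* r) √5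
  where r = recip (a ℚ.* a ℚ.- + 5 ℚ./ 1 ℚ.* (b ℚ.* b))

_/₅_ : ℚ√5 → ℚ√5 → ℚ√5
x /₅ y = x *₅ y ⁻¹₅

-- The order induced from ℝ, where √5 > 0: the real number a + b√5 is positive iff the
-- summand of larger absolute value is positive, and |a| = |b√5| only for a = b = 0.
Positive : ℚ√5 → Set
Positive (a + b √5) =
    (0ℚ ℚ.< a × + 5 ℚ./ 1 ℚ.* (b ℚ.* b) ℚ.< a ℚ.* a)
  ⊎ (0ℚ ℚ.< b × a ℚ.* a ℚ.< + 5 ℚ./ 1 ℚ.* (b ℚ.* b))

_<₅_ : Rel ℚ√5 0ℓ
x <₅ y = Positive (y -₅ x)

φ : ℚ√5
φ = (fromℕ₅ 1 +₅ √5) /₅ fromℕ₅ 2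

-- Convergence as real numbers; rational ε suffice since ℚ is dense in ℝ.
_⟶_ : (ℕ → ℚ√5) → ℚ√5 → Set
u ⟶ l = ∀ (ε : ℚ) → 0ℚ ℚ.< ε → ∃[ N ] ∀ n → N ℕ.≤ n →
  l -₅ fromℚ ε <₅ u n × u n <₅ l +₅ fromℚ ε

-- With the convention for division by zero, u ∼ v forces v n ≠ 0 for all large n.
infix 4 _⟶_ _∼_
_∼_ : (ℕ → ℚ√5) → (ℕ → ℚ√5) → Set
u ∼ v = (λ n → u n /₅ v n) ⟶ fromℕ₅ 1

{-# OPTIONS --safe #-}
module Submission where

-- A Fibonacci path is a word in H and UD. For two paths with the same first letter, covering is covering of the
-- remainders, and H γ ⋖ UD δ exactly when γ = H δ, while UD γ never lies below H δ. Hence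
-- ℓₙ₊₂ = ℓₙ₊₁ + ℓₙ + |𝓕ₙ| with |𝓕ₙ| = Fₙ₊₁, which gives the series, through the linear recurrence with
-- characteristic polynomial (x² - x - 1)², and 5ℓₙ = n Lₙ - Fₙ. For the asymptotics, φⁿ = (Lₙ + Fₙ√5)/2 has
-- norm ±1, so the two quotients have explicit rational coordinates in ℚ(√5), and that they lie within ε of 1
-- becomes a comparison of a² with 5b², where Lₙ² = 5Fₙ² ± 4 cancels the leading terms.

-- Each limit is proved with an explicit ε, by showing that certain numbers a + b√5 are positive.
-- After a positive common denominator is cleared, a and b are polynomials in n, Lₙ, Fₙ, ε and the
-- sign (-1)ⁿ. The obstacle is cancellation: a and b√5 have opposite signs and agree to leading
-- order wherever the estimate is delicate, so separate bounds on them say nothing. Only the exact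
-- value of a² - 5b² does, and for the first quotient the parity of n decides which of the two
-- halves of `Positive` is the right one. Every polynomial inequality then rests on a certificate:
-- the difference of its sides is written as a sum of products of nonnegative factors, if necessary
-- plus a multiple of L² - 5F² - 4σ. The local lemmas `expand` are these certificates, left to the
-- ring solver; the proof terms built from `_⊕_` and `_⊗_` repeat their shape summand by summand.

open import Defs
open import Data.Bool.Base using (true; false)
open import Data.Fin.Base using (zero; suc)
open import Data.Integer.Base as ℤ using (ℤ; +_; 0ℤ; 1ℤ; -1ℤ)
import Data.Integer.Properties as ℤ
import Data.Integer.Tactic.RingSolver as ℤ-Ring
open import Data.List.Base as List using (List; []; _∷_; _++_; length; filter; cartesianProduct; foldr; applyUpTo)
open import Data.List.Membership.Propositional using (_∈_)
open import Data.List.Membership.Propositional.Properties using (∈-map⁻; ∈-++⁻)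
open import Data.List.Properties using (map-++; map-∘; map-cong; length-map; length-++)
open import Data.List.Relation.Unary.All as All using (All; []; _∷_)
open import Data.List.Relation.Unary.AllPairs using (_∷_)
open import Data.List.Relation.Unary.Any using (here; there)
open import Data.List.Relation.Unary.Unique.Propositional using (Unique)
open import Data.Nat.Base as ℕ using (ℕ; zero; suc)
open import Data.Nat.Divisibility using (_∣_; divides; m∣m*n)
open import Data.Nat.Induction using (<-rec)
open import Data.Nat.ListAction using (sum)
open import Data.Nat.ListAction.Properties using (sum-++)
open import Data.Nat.Primality using (euclidsLemma; prime?)
import Data.Nat.Properties as ℕ
import Data.Nat.Tactic.RingSolver as ℕ-Ring
open import Data.Product.Base using (∃-syntax; _×_; _,_; proj₁; proj₂)
open import Data.Rational.Base as ℚ using (ℚ; mkℚ; 0ℚ; 1ℚ; ½; toℚᵘ)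
import Data.Rational.Properties as ℚ
open import Data.Rational.Unnormalised.Base as ℚᵘ using (mkℚᵘ; *≡*)
import Data.Rational.Unnormalised.Properties as ℚᵘ
open import Data.Sum.Base using (_⊎_; inj₁; inj₂; reduce)
open import Data.Vec.Base using (Vec; []; _∷_)
import Data.Vec.Properties as Vec
open import Function.Base using (_∘_)
open import Function.Bundles using (_⇔_; mk⇔)
open import Relation.Binary.Definitions using (DecidableEquality; tri<; tri≈; tri>)
open import Relation.Binary.PropositionalEquality
open import Relation.Binary.Structures using (IsDecPartialOrder)
open import Relation.Nullary.Decidable using (Dec; does; yes; no; dec-true; dec-false; does-⇔; dec⇒maybe; from-yes)
open import Relation.Nullary.Negation using (¬_; contradiction)
import Relation.Unary as Unary
open import Tactic.RingSolver using (solve-∀)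
import Tactic.RingSolver.Core.AlmostCommutativeRing as ACR

-- Counting

module _ {A : Set} where

  ∑ : List A → (A → ℕ) → ℕ
  ∑ xs f = sum (List.map f xs)

  syntax ∑ xs (λ x → e) = ∑[ x ← xs ] e
  infix 5 ∑

  ∑-cong : ∀ {f g} xs → f ≗ g → ∑ xs f ≡ ∑ xs g
  ∑-cong xs f≗g = cong sum (map-cong f≗g xs)

  ∑-++ : ∀ f xs ys → ∑ (xs ++ ys) f ≡ ∑ xs f ℕ.+ ∑ ys f
  ∑-++ f xs ys = trans (cong sum (map-++ f xs ys)) (sum-++ (List.map f xs) (List.map f ys))

  ∑-zero : ∀ xs → ∑ xs (λ _ → 0) ≡ 0
  ∑-zero []       = refl
  ∑-zero (_ ∷ xs) = ∑-zero xs

  ∑-one : ∀ xs → ∑ xs (λ _ → 1) ≡ length xs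
  ∑-one []       = refl
  ∑-one (_ ∷ xs) = cong suc (∑-one xs)

  ∑-+ : ∀ f g xs → ∑[ x ← xs ] (f x ℕ.+ g x) ≡ ∑ xs f ℕ.+ ∑ xs g
  ∑-+ f g []       = refl
  ∑-+ f g (x ∷ xs) = trans (cong (f x ℕ.+ g x ℕ.+_) (∑-+ f g xs)) (swap (f x) (g x) _ _)
    where
    swap : ∀ a b c d → a ℕ.+ b ℕ.+ (c ℕ.+ d) ≡ a ℕ.+ c ℕ.+ (b ℕ.+ d)
    swap = ℕ-Ring.solve-∀

∑-map : ∀ {A B : Set} (h : A → B) f xs → ∑ (List.map h xs) f ≡ ∑[ x ← xs ] f (h x)
∑-map h f xs = cong sum (sym (map-∘ xs))

∑-comm : ∀ {A B : Set} (f : A → B → ℕ) xs ys → ∑[ x ← xs ] ∑[ y ← ys ] f x y ≡ ∑[ y ← ys ] ∑[ x ← xs ] f x y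
∑-comm f []       ys = sym (∑-zero ys)
∑-comm f (x ∷ xs) ys = trans (cong (∑ ys (f x) ℕ.+_) (∑-comm f xs ys)) (sym (∑-+ (f x) _ ys))

∑-cartesianProduct : ∀ {A B : Set} (f : A × B → ℕ) xs ys →
  ∑ (cartesianProduct xs ys) f ≡ ∑[ x ← xs ] ∑[ y ← ys ] f (x , y)
∑-cartesianProduct f []       ys = refl
∑-cartesianProduct f (x ∷ xs) ys =
  trans (∑-++ f (List.map (x ,_) ys) _) (cong₂ ℕ._+_ (∑-map (x ,_) f ys) (∑-cartesianProduct f xs ys))

∑∑-++ : ∀ {A B : Set} (f : A → B → ℕ) xs ys us vs →
  ∑[ x ← xs ++ ys ] ∑[ u ← us ++ vs ] f x u ≡
  (∑[ x ← xs ] ∑[ u ← us ] f x u) ℕ.+ (∑[ x ← xs ] ∑[ v ← vs ] f x v)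
    ℕ.+ ((∑[ y ← ys ] ∑[ u ← us ] f y u) ℕ.+ (∑[ y ← ys ] ∑[ v ← vs ] f y v))
∑∑-++ f xs ys us vs = trans (∑-++ _ xs ys) (cong₂ ℕ._+_ (split xs) (split ys))
  where
  split : ∀ zs → ∑[ z ← zs ] ∑[ u ← us ++ vs ] f z u ≡
                 (∑[ z ← zs ] ∑[ u ← us ] f z u) ℕ.+ (∑[ z ← zs ] ∑[ v ← vs ] f z v)
  split zs = trans (∑-cong zs λ z → ∑-++ (f z) us vs) (∑-+ _ _ zs)

-- Inspects only the Boolean `does`, as `filter` does, so the proofs carried by two decisions never
-- have to be compared.
𝟙 : ∀ {P : Set} → Dec P → ℕ
𝟙 p? with does p?
... | true  = 1
... | false = 0

𝟙-⇔ : ∀ {P Q : Set} → P ⇔ Q → (p? : Dec P) (q? : Dec Q) → 𝟙 p? ≡ 𝟙 q?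
𝟙-⇔ P⇔Q p? q? with does p? | does q? | does-⇔ P⇔Q p? q?
... | true  | _ | refl = refl
... | false | _ | refl = refl

𝟙-true : ∀ {P : Set} (p? : Dec P) → P → 𝟙 p? ≡ 1
𝟙-true p? p with does p? | dec-true p? p
... | _ | refl = refl

𝟙-false : ∀ {P : Set} (p? : Dec P) → ¬ P → 𝟙 p? ≡ 0
𝟙-false p? ¬p with does p? | dec-false p? ¬p
... | _ | refl = refl

length-filter≡∑ : ∀ {A : Set} {P : A → Set} (P? : Unary.Decidable P) xs → length (filter P? xs) ≡ ∑[ x ← xs ] 𝟙 (P? x)
length-filter≡∑ P? []       = refl
length-filter≡∑ P? (x ∷ xs) with does (P? x)
... | true  = cong suc (length-filter≡∑ P? xs)
... | false = length-filter≡∑ P? xs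

module _ {A : Set} (_≟_ : DecidableEquality A) where

  ∑-𝟙-∉ : ∀ {z xs} → All (z ≢_) xs → ∑[ x ← xs ] 𝟙 (x ≟ z) ≡ 0
  ∑-𝟙-∉ []           = refl
  ∑-𝟙-∉ (z≢x ∷ z∉xs) = cong₂ ℕ._+_ (𝟙-false (_ ≟ _) (z≢x ∘ sym)) (∑-𝟙-∉ z∉xs)

  ∑-𝟙-∈ : ∀ {z xs} → Unique xs → z ∈ xs → ∑[ x ← xs ] 𝟙 (x ≟ z) ≡ 1
  ∑-𝟙-∈ (x∉xs ∷ _)  (here refl)  = cong₂ ℕ._+_ (𝟙-true (_ ≟ _) refl) (∑-𝟙-∉ x∉xs)
  ∑-𝟙-∈ (x∉xs ∷ uq) (there z∈xs) = cong₂ ℕ._+_ (𝟙-false (_ ≟ _) (All.lookup x∉xs z∈xs)) (∑-𝟙-∈ uq z∈xs)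

ℓ≡∑ : ∀ P → ℓ P ≡ ∑[ x ← FinitePoset.elements P ] ∑[ y ← FinitePoset.elements P ] 𝟙 (FinitePoset._⋖?_ P x y)
ℓ≡∑ P = trans (length-filter≡∑ _ (cartesianProduct elements elements)) (∑-cartesianProduct _ elements elements)
  where open FinitePoset P

-- Covering relations between Fibonacci paths

module 𝓕 {n} = FinitePoset (𝓕 n)
open 𝓕 using (_⋖_; _⋖?_; _≟_) renaming (_<_ to _⊏_)

⊑-antisym : ∀ {n} (γ δ : FibonacciPath n) → γ ⊑ δ → δ ⊑ γ → γ ≡ δ
⊑-antisym γ δ = IsDecPartialOrder.antisym ⊑-isDecPartialOrder

H∷-mono-⊑ : ∀ {n} (γ δ : FibonacciPath n) → γ ⊑ δ → H∷ γ ⊑ H∷ δ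
H∷-mono-⊑ γ δ γ⊑δ zero    = ℤ.≤-refl
H∷-mono-⊑ γ δ γ⊑δ (suc k) = ℤ.+-monoʳ-≤ 0ℤ (γ⊑δ k)

H∷-cancel-⊑ : ∀ {n} (γ δ : FibonacciPath n) → H∷ γ ⊑ H∷ δ → γ ⊑ δ
H∷-cancel-⊑ γ δ p k = subst₂ ℤ._≤_ (ℤ.+-identityˡ _) (ℤ.+-identityˡ _) (p (suc k))

UD∷-mono-⊑ : ∀ {n} (γ δ : FibonacciPath n) → γ ⊑ δ → UD∷ γ ⊑ UD∷ δ
UD∷-mono-⊑ γ δ γ⊑δ zero          = ℤ.≤-refl
UD∷-mono-⊑ γ δ γ⊑δ (suc zero)    = ℤ.≤-refl
UD∷-mono-⊑ γ δ γ⊑δ (suc (suc k)) = ℤ.+-monoʳ-≤ 1ℤ (ℤ.+-monoʳ-≤ -1ℤ (γ⊑δ k))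

UD∷-cancel-⊑ : ∀ {n} (γ δ : FibonacciPath n) → UD∷ γ ⊑ UD∷ δ → γ ⊑ δ
UD∷-cancel-⊑ γ δ p k = subst₂ ℤ._≤_ (UD-height _) (UD-height _) (p (suc (suc k)))

H∷-injective : ∀ {n} (γ δ : FibonacciPath n) → H∷ γ ≡ H∷ δ → γ ≡ δ
H∷-injective γ δ eq = steps-injective (Vec.∷-injectiveʳ (cong steps eq))

UD∷-injective : ∀ {n} (γ δ : FibonacciPath n) → UD∷ γ ≡ UD∷ δ → γ ≡ δ
UD∷-injective γ δ eq = steps-injective (Vec.∷-injectiveʳ (Vec.∷-injectiveʳ (cong steps eq)))

H∷≢UD∷ : ∀ {n} (γ : FibonacciPath (suc n)) (δ : FibonacciPath n) → H∷ γ ≢ UD∷ δ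
H∷≢UD∷ γ δ eq with () ← Vec.∷-injectiveˡ (cong steps eq)

UD∷⋢H∷ : ∀ {n} (γ : FibonacciPath n) (δ : FibonacciPath (suc n)) → ¬ (UD∷ γ ⊑ H∷ δ)
UD∷⋢H∷ γ δ p with ℤ.+≤+ () ← p (suc zero)

-- UD δ and HH δ have equal heights except at abscissa 1, and there a path that starts with H has
-- height 0 anyway.
H∷⊑UD∷⁻ : ∀ {n} (γ : FibonacciPath (suc n)) (δ : FibonacciPath n) → H∷ γ ⊑ UD∷ δ → γ ⊑ H∷ δ
H∷⊑UD∷⁻ γ δ p zero    = ℤ.≤-refl
H∷⊑UD∷⁻ γ δ p (suc k) = subst₂ ℤ._≤_ (ℤ.+-identityˡ _) (trans (UD-height h) (sym (ℤ.+-identityˡ h))) (p (suc (suc k)))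
  where h = height (steps δ) k

H∷⊑UD∷⁺ : ∀ {n} (γ : FibonacciPath (suc n)) (δ : FibonacciPath n) → γ ⊑ H∷ δ → H∷ γ ⊑ UD∷ δ
H∷⊑UD∷⁺ γ δ p zero          = ℤ.≤-refl
H∷⊑UD∷⁺ γ δ p (suc zero)    = ℤ.+≤+ ℕ.z≤n
H∷⊑UD∷⁺ γ δ p (suc (suc k)) =
  subst₂ ℤ._≤_ (sym (ℤ.+-identityˡ _)) (trans (ℤ.+-identityˡ h) (sym (UD-height h))) (p (suc k))
  where h = height (steps δ) k

H∷-mono-⊏ : ∀ {n} (γ δ : FibonacciPath n) → γ ⊏ δ → H∷ γ ⊏ H∷ δ
H∷-mono-⊏ γ δ (γ⊑δ , γ≢δ) = H∷-mono-⊑ γ δ γ⊑δ , γ≢δ ∘ H∷-injective γ δ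

H∷-cancel-⊏ : ∀ {n} (γ δ : FibonacciPath n) → H∷ γ ⊏ H∷ δ → γ ⊏ δ
H∷-cancel-⊏ γ δ (p , γ≢δ) = H∷-cancel-⊑ γ δ p , γ≢δ ∘ cong H∷_

UD∷-mono-⊏ : ∀ {n} (γ δ : FibonacciPath n) → γ ⊏ δ → UD∷ γ ⊏ UD∷ δ
UD∷-mono-⊏ γ δ (γ⊑δ , γ≢δ) = UD∷-mono-⊑ γ δ γ⊑δ , γ≢δ ∘ UD∷-injective γ δ

UD∷-cancel-⊏ : ∀ {n} (γ δ : FibonacciPath n) → UD∷ γ ⊏ UD∷ δ → γ ⊏ δ
UD∷-cancel-⊏ γ δ (p , γ≢δ) = UD∷-cancel-⊑ γ δ p , γ≢δ ∘ cong UD∷_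

-- The case analysis on steps was already made in proving the enumeration complete, so it is read
-- off from membership there.
first-step : ∀ {n} (γ : FibonacciPath (suc (suc n))) → (∃[ δ ] γ ≡ H∷ δ) ⊎ (∃[ δ ] γ ≡ UD∷ δ)
first-step {n} γ with ∈-++⁻ (List.map H∷_ (fibonacciPaths (suc n))) (fibonacciPaths-complete (suc (suc n)) γ)
... | inj₁ p with δ , _ , eq ← ∈-map⁻ H∷_ p  = inj₁ (δ , eq)
... | inj₂ p with δ , _ , eq ← ∈-map⁻ UD∷_ p = inj₂ (δ , eq)

-- Prepending H could destroy a covering only through a new intermediate path starting with UD, but
-- such a path is not below H δ. Dually, in `UD∷⋖UD∷` a path starting with H is not above UD γ.
H∷⋖H∷ : ∀ {n} (γ δ : FibonacciPath (suc n)) → (H∷ γ ⋖ H∷ δ) ⇔ (γ ⋖ δ)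
H∷⋖H∷ γ δ = mk⇔
  (λ (p , none) → H∷-cancel-⊏ γ δ p , λ ζ (q , r) → none (H∷ ζ) (H∷-mono-⊏ γ ζ q , H∷-mono-⊏ ζ δ r))
  (λ (p , none) → H∷-mono-⊏ γ δ p , nothing-between none)
  where
  nothing-between : (∀ ζ → ¬ (γ ⊏ ζ × ζ ⊏ δ)) → ∀ ζ → ¬ (H∷ γ ⊏ ζ × ζ ⊏ H∷ δ)
  nothing-between none ζ (q , r) with first-step ζ
  ... | inj₁ (ζ′ , refl) = none ζ′ (H∷-cancel-⊏ γ ζ′ q , H∷-cancel-⊏ ζ′ δ r)
  ... | inj₂ (ζ′ , refl) = UD∷⋢H∷ ζ′ δ (proj₁ r)

UD∷⋖UD∷ : ∀ {n} (γ δ : FibonacciPath n) → (UD∷ γ ⋖ UD∷ δ) ⇔ (γ ⋖ δ)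
UD∷⋖UD∷ γ δ = mk⇔
  (λ (p , none) → UD∷-cancel-⊏ γ δ p , λ ζ (q , r) → none (UD∷ ζ) (UD∷-mono-⊏ γ ζ q , UD∷-mono-⊏ ζ δ r))
  (λ (p , none) → UD∷-mono-⊏ γ δ p , nothing-between none)
  where
  nothing-between : (∀ ζ → ¬ (γ ⊏ ζ × ζ ⊏ δ)) → ∀ ζ → ¬ (UD∷ γ ⊏ ζ × ζ ⊏ UD∷ δ)
  nothing-between none ζ (q , r) with first-step ζ
  ... | inj₁ (ζ′ , refl) = UD∷⋢H∷ γ ζ′ (proj₁ q)
  ... | inj₂ (ζ′ , refl) = none ζ′ (UD∷-cancel-⊏ γ ζ′ q , UD∷-cancel-⊏ ζ′ δ r)

-- H∷ H∷ δ is the largest path below UD∷ δ that starts with H.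
H∷⋖UD∷ : ∀ {n} (γ : FibonacciPath (suc n)) (δ : FibonacciPath n) → (H∷ γ ⋖ UD∷ δ) ⇔ (γ ≡ H∷ δ)
H∷⋖UD∷ {n} γ δ = mk⇔ to from
  where
  HHδ⊏UDδ : H∷ H∷ δ ⊏ UD∷ δ
  HHδ⊏UDδ = H∷⊑UD∷⁺ (H∷ δ) δ (λ k → ℤ.≤-refl) , H∷≢UD∷ (H∷ δ) δ

  to : H∷ γ ⋖ UD∷ δ → γ ≡ H∷ δ
  to ((p , _) , none) with γ ≟ H∷ δ
  ... | yes eq  = eq
  ... | no  neq = contradiction (H∷-mono-⊏ γ (H∷ δ) (H∷⊑UD∷⁻ γ δ p , neq) , HHδ⊏UDδ) (none (H∷ H∷ δ))

  nothing-between : ∀ ζ → ¬ (H∷ H∷ δ ⊏ ζ × ζ ⊏ UD∷ δ)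
  -- Either first letter makes ζ an endpoint: if ζ = H ζ′, both bounds compare ζ′ with H δ; if ζ =
  -- UD ζ′, the lower bound HH δ ⊑ UD ζ′ already gives δ ⊑ ζ′.
  nothing-between ζ (q , r) with first-step ζ
  ... | inj₁ (ζ′ , refl) = proj₂ q (cong H∷_
    (⊑-antisym (H∷ δ) ζ′ (H∷-cancel-⊑ (H∷ δ) ζ′ (proj₁ q)) (H∷⊑UD∷⁻ ζ′ δ (proj₁ r))))
  ... | inj₂ (ζ′ , refl) = proj₂ r (cong UD∷_
    (⊑-antisym ζ′ δ (UD∷-cancel-⊑ ζ′ δ (proj₁ r)) (H∷-cancel-⊑ δ ζ′ (H∷⊑UD∷⁻ (H∷ δ) ζ′ (proj₁ q)))))

  from : γ ≡ H∷ δ → H∷ γ ⋖ UD∷ δ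
  from refl = HHδ⊏UDδ , nothing-between

-- Recurrences for the number of edges and of paths

ℓ-rec : ∀ n → ℓ (𝓕 (suc (suc n))) ≡ ℓ (𝓕 (suc n)) ℕ.+ ∣ 𝓕 n ∣ ℕ.+ ℓ (𝓕 n)
ℓ-rec n = begin
  ℓ (𝓕 (suc (suc n)))
    ≡⟨ ℓ≡∑ (𝓕 (suc (suc n))) ⟩
  ∑[ x ← Hs ++ UDs ] ∑[ y ← Hs ++ UDs ] c x y
    ≡⟨ ∑∑-++ c Hs UDs Hs UDs ⟩
  (∑[ x ← Hs ] ∑[ y ← Hs ] c x y) ℕ.+ (∑[ x ← Hs ] ∑[ y ← UDs ] c x y)
    ℕ.+ ((∑[ x ← UDs ] ∑[ y ← Hs ] c x y) ℕ.+ (∑[ x ← UDs ] ∑[ y ← UDs ] c x y))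
    ≡⟨ cong₂ ℕ._+_ (cong₂ ℕ._+_ HH HU) (cong₂ ℕ._+_ UH UU) ⟩
  ℓ (𝓕 (suc n)) ℕ.+ ∣ 𝓕 n ∣ ℕ.+ ℓ (𝓕 n) ∎
  where
  open ≡-Reasoning
  P₁ = fibonacciPaths (suc n)
  P₀ = fibonacciPaths n
  Hs = List.map H∷_ P₁
  UDs = List.map UD∷_ P₀
  c : FibonacciPath (suc (suc n)) → FibonacciPath (suc (suc n)) → ℕ
  c x y = 𝟙 (x ⋖? y)

  ∑∑-map : ∀ {A B : Set} (g : A → FibonacciPath (suc (suc n))) (h : B → FibonacciPath (suc (suc n))) xs ys →
    ∑[ x ← List.map g xs ] ∑[ y ← List.map h ys ] c x y ≡ ∑[ x ← xs ] ∑[ y ← ys ] c (g x) (h y)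
  ∑∑-map g h xs ys = trans (∑-map g _ xs) (∑-cong xs λ x → ∑-map h (c (g x)) ys)

  HH : ∑[ x ← Hs ] ∑[ y ← Hs ] c x y ≡ ℓ (𝓕 (suc n))
  HH = trans (∑∑-map H∷_ H∷_ P₁ P₁)
    (trans (∑-cong P₁ λ γ → ∑-cong P₁ λ δ → 𝟙-⇔ (H∷⋖H∷ γ δ) (H∷ γ ⋖? H∷ δ) (γ ⋖? δ)) (sym (ℓ≡∑ (𝓕 (suc n)))))

  UU : ∑[ x ← UDs ] ∑[ y ← UDs ] c x y ≡ ℓ (𝓕 n)
  UU = trans (∑∑-map UD∷_ UD∷_ P₀ P₀)
    (trans (∑-cong P₀ λ γ → ∑-cong P₀ λ δ → 𝟙-⇔ (UD∷⋖UD∷ γ δ) (UD∷ γ ⋖? UD∷ δ) (γ ⋖? δ)) (sym (ℓ≡∑ (𝓕 n))))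

  UH : ∑[ x ← UDs ] ∑[ y ← Hs ] c x y ≡ 0
  UH = trans (∑∑-map UD∷_ H∷_ P₀ P₁)
    (trans (∑-cong P₀ λ γ → trans (∑-cong P₁ λ δ → 𝟙-false (UD∷ γ ⋖? H∷ δ) (UD∷⋢H∷ γ δ ∘ proj₁ ∘ proj₁)) (∑-zero P₁))
           (∑-zero P₀))

  HU : ∑[ x ← Hs ] ∑[ y ← UDs ] c x y ≡ ∣ 𝓕 n ∣
  HU = begin
    ∑[ x ← Hs ] ∑[ y ← UDs ] c x y
      ≡⟨ ∑∑-map H∷_ UD∷_ P₁ P₀ ⟩
    ∑[ γ ← P₁ ] ∑[ δ ← P₀ ] 𝟙 (H∷ γ ⋖? UD∷ δ)
      ≡⟨ ∑-cong P₁ (λ γ → ∑-cong P₀ λ δ → 𝟙-⇔ (H∷⋖UD∷ γ δ) (H∷ γ ⋖? UD∷ δ) (γ ≟ H∷ δ)) ⟩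
    ∑[ γ ← P₁ ] ∑[ δ ← P₀ ] 𝟙 (γ ≟ H∷ δ)
      -- With δ outermost every inner sum is 1; with γ outermost it would be 0 for each γ that does
      -- not start with H.
      ≡⟨ ∑-comm _ P₁ P₀ ⟩
    ∑[ δ ← P₀ ] ∑[ γ ← P₁ ] 𝟙 (γ ≟ H∷ δ)
      ≡⟨ ∑-cong P₀ (λ δ → ∑-𝟙-∈ _≟_ (fibonacciPaths-unique (suc n)) (fibonacciPaths-complete (suc n) (H∷ δ))) ⟩
    ∑ P₀ (λ _ → 1)
      ≡⟨ ∑-one P₀ ⟩
    ∣ 𝓕 n ∣ ∎

∣𝓕∣≡F : ∀ n → ∣ 𝓕 n ∣ ≡ F (suc n)
∣𝓕∣≡F zero          = refl
∣𝓕∣≡F (suc zero)    = refl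
∣𝓕∣≡F (suc (suc n)) = begin
  length (List.map H∷_ (fibonacciPaths (suc n)) ++ List.map UD∷_ (fibonacciPaths n))
    ≡⟨ length-++ (List.map H∷_ (fibonacciPaths (suc n))) ⟩
  length (List.map H∷_ (fibonacciPaths (suc n))) ℕ.+ length (List.map UD∷_ (fibonacciPaths n))
    ≡⟨ cong₂ ℕ._+_ (length-map H∷_ (fibonacciPaths (suc n))) (length-map UD∷_ (fibonacciPaths n)) ⟩
  ∣ 𝓕 (suc n) ∣ ℕ.+ ∣ 𝓕 n ∣
    ≡⟨ cong₂ ℕ._+_ (∣𝓕∣≡F (suc n)) (∣𝓕∣≡F n) ⟩
  F (suc (suc (suc n))) ∎
  where open ≡-Reasoning

-- The generating series

foldr-applyUpTo-zero : ∀ f n → (∀ k → f k ≡ 0ℤ) → foldr ℤ._+_ 0ℤ (applyUpTo f n) ≡ 0ℤ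
foldr-applyUpTo-zero f zero    _   = refl
foldr-applyUpTo-zero f (suc n) f≡0 = cong₂ ℤ._+_ (f≡0 0) (foldr-applyUpTo-zero (λ k → f (suc k)) n (λ k → f≡0 (suc k)))

dot-zero : ∀ {n} h (as : Vec ℤ n) → (∀ k → h k ≡ 0ℤ) → dot h as ≡ 0ℤ
dot-zero h []       _   = refl
dot-zero h (a ∷ as) h≡0 = cong₂ ℤ._+_
  (trans (cong (ℤ._* a) (h≡0 0)) (ℤ.*-zeroˡ a))
  (dot-zero (λ k → h (suc k)) as (λ k → h≡0 (suc k)))

-- At an index of the form 2 + n the first three summands of the convolution split off by
-- computation; the other n carry coefficients of p of degree at least 3.
*ₛ-quadratic : ∀ p g → (∀ k → p (3 ℕ.+ k) ≡ 0ℤ) →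
  ∀ n → (p *ₛ g) (2 ℕ.+ n) ≡ p 0 ℤ.* g (2 ℕ.+ n) ℤ.+ (p 1 ℤ.* g (1 ℕ.+ n) ℤ.+ p 2 ℤ.* g n)
*ₛ-quadratic p g p≡0 n = cong (λ s → p 0 ℤ.* g (2 ℕ.+ n) ℤ.+ (p 1 ℤ.* g (1 ℕ.+ n) ℤ.+ s))
  (trans (cong (λ s → p 2 ℤ.* g n ℤ.+ s) (foldr-applyUpTo-zero _ n λ k →
     trans (cong (ℤ._* g (n ℕ.∸ suc k)) (p≡0 k)) (ℤ.*-zeroˡ (g (n ℕ.∸ suc k)))))
   (ℤ.+-identityʳ _))

X²-zero : ∀ k → (X ^ₛ 2) (3 ℕ.+ k) ≡ 0ℤ
X²-zero k = begin
  (X *ₛ (X *ₛ 1ₛ)) (3 ℕ.+ k)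
    ≡⟨ *ₛ-quadratic X (X *ₛ 1ₛ) (λ _ → refl) (suc k) ⟩
  0ℤ ℤ.* (X *ₛ 1ₛ) (3 ℕ.+ k) ℤ.+ (1ℤ ℤ.* (X *ₛ 1ₛ) (2 ℕ.+ k) ℤ.+ 0ℤ ℤ.* (X *ₛ 1ₛ) (1 ℕ.+ k))
    ≡⟨ linear ((X *ₛ 1ₛ) (3 ℕ.+ k)) ((X *ₛ 1ₛ) (2 ℕ.+ k)) ((X *ₛ 1ₛ) (1 ℕ.+ k)) ⟩
  (X *ₛ 1ₛ) (2 ℕ.+ k)
    ≡⟨ *ₛ-quadratic X 1ₛ (λ _ → refl) k ⟩
  0ℤ ℤ.* 0ℤ ℤ.+ (1ℤ ℤ.* 0ℤ ℤ.+ 0ℤ ℤ.* 1ₛ k)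
    ≡⟨ linear 0ℤ 0ℤ (1ₛ k) ⟩
  0ℤ ∎
  where
  open ≡-Reasoning
  linear : ∀ a b c → 0ℤ ℤ.* a ℤ.+ (1ℤ ℤ.* b ℤ.+ 0ℤ ℤ.* c) ≡ b
  linear = ℤ-Ring.solve-∀

𝐝 : Series
𝐝 = 1ₛ -ₛ X -ₛ X ^ₛ 2

𝐝-zero : ∀ k → 𝐝 (3 ℕ.+ k) ≡ 0ℤ
𝐝-zero k = cong (λ a → 0ℤ ℤ.- 0ℤ ℤ.- a) (X²-zero k)

-- The square `𝐝 ^ₛ 2` unfolds to `𝐝 *ₛ (𝐝 *ₛ 1ₛ)`, so its inner factor must be known to be
-- quadratic as well.
𝐝*1ₛ-zero : ∀ k → (𝐝 *ₛ 1ₛ) (3 ℕ.+ k) ≡ 0ℤ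
𝐝*1ₛ-zero k = *ₛ-quadratic 𝐝 1ₛ 𝐝-zero (suc k)

𝐝²-zero : ∀ k → (𝐝 ^ₛ 2) (5 ℕ.+ k) ≡ 0ℤ
𝐝²-zero k = trans (*ₛ-quadratic 𝐝 (𝐝 *ₛ 1ₛ) 𝐝-zero (3 ℕ.+ k))
  (cong₂ (λ a b → 1ℤ ℤ.* a ℤ.+ b) (𝐝*1ₛ-zero (2 ℕ.+ k))
    (cong₂ (λ a b → -1ℤ ℤ.* a ℤ.+ -1ℤ ℤ.* b) (𝐝*1ₛ-zero (1 ℕ.+ k)) (𝐝*1ₛ-zero k)))

𝐪 : Series
𝐪 = X ^ₛ 2 /ₛ 𝐝 ^ₛ 2

Recurrence₄ : Series → Set
Recurrence₄ u = ∀ n → u (4 ℕ.+ n) ≡ + 2 ℤ.* u (3 ℕ.+ n) ℤ.+ u (2 ℕ.+ n) ℤ.- + 2 ℤ.* u (1 ℕ.+ n) ℤ.- u n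

𝐪-recurrence₄ : Recurrence₄ 𝐪
𝐪-recurrence₄ n = begin
  𝐪 (4 ℕ.+ n)
    -- One step of the long division. The multipliers come from (1 - x - x²)² = 1 - 2x - x² + 2x³ +
    -- x⁴; the dividend x² has no coefficient here, and `d` collects the older quotients, which meet
    -- coefficients of degree at least 5.
    ≡⟨ cong₂ (λ a d → a ℤ.- (ℤ.- + 2 ℤ.* 𝐪 (3 ℕ.+ n) ℤ.+ (-1ℤ ℤ.* 𝐪 (2 ℕ.+ n) ℤ.+
                            (+ 2 ℤ.* 𝐪 (1 ℕ.+ n) ℤ.+ (1ℤ ℤ.* 𝐪 n ℤ.+ d)))))
             (X²-zero (1 ℕ.+ n)) (dot-zero _ (quotient (X ^ₛ 2) (𝐝 ^ₛ 2) n) 𝐝²-zero) ⟩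
  0ℤ ℤ.- (ℤ.- + 2 ℤ.* 𝐪 (3 ℕ.+ n) ℤ.+ (-1ℤ ℤ.* 𝐪 (2 ℕ.+ n) ℤ.+
         (+ 2 ℤ.* 𝐪 (1 ℕ.+ n) ℤ.+ (1ℤ ℤ.* 𝐪 n ℤ.+ 0ℤ))))
    ≡⟨ tidy (𝐪 (3 ℕ.+ n)) (𝐪 (2 ℕ.+ n)) (𝐪 (1 ℕ.+ n)) (𝐪 n) ⟩
  + 2 ℤ.* 𝐪 (3 ℕ.+ n) ℤ.+ 𝐪 (2 ℕ.+ n) ℤ.- + 2 ℤ.* 𝐪 (1 ℕ.+ n) ℤ.- 𝐪 n ∎
  where
  open ≡-Reasoning
  tidy : ∀ a b c d → 0ℤ ℤ.- (ℤ.- + 2 ℤ.* a ℤ.+ (-1ℤ ℤ.* b ℤ.+ (+ 2 ℤ.* c ℤ.+ (1ℤ ℤ.* d ℤ.+ 0ℤ)))) ≡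
                     + 2 ℤ.* a ℤ.+ b ℤ.- + 2 ℤ.* c ℤ.- d
  tidy = ℤ-Ring.solve-∀

ℓ-F : ∀ n → ℓ (𝓕 (2 ℕ.+ n)) ≡ ℓ (𝓕 (1 ℕ.+ n)) ℕ.+ F (suc n) ℕ.+ ℓ (𝓕 n)
ℓ-F n = trans (ℓ-rec n) (cong (λ m → ℓ (𝓕 (suc n)) ℕ.+ m ℕ.+ ℓ (𝓕 n)) (∣𝓕∣≡F n))

ℓℤ : ℕ → ℤ
ℓℤ n = + ℓ (𝓕 n)

ℓℤ-F : ∀ n → ℓℤ (2 ℕ.+ n) ≡ ℓℤ (1 ℕ.+ n) ℤ.+ + F (suc n) ℤ.+ ℓℤ n
ℓℤ-F n = cong +_ (ℓ-F n)

-- The inhomogeneous term F of `ℓℤ-F` itself satisfies the Fibonacci recurrence, so three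
-- consecutive instances suffice to eliminate it.
ℓ-recurrence₄ : Recurrence₄ ℓℤ
ℓ-recurrence₄ n = eliminate (ℓℤ (3 ℕ.+ n)) (ℓℤ (2 ℕ.+ n)) (ℓℤ (1 ℕ.+ n)) (ℓℤ n) (+ F (1 ℕ.+ n)) (+ F (2 ℕ.+ n))
  (ℓℤ-F (2 ℕ.+ n)) (ℓℤ-F (1 ℕ.+ n)) (ℓℤ-F n)
  where
  solved : ∀ c u d v → let b = c ℤ.+ u ℤ.+ d; x = b ℤ.+ v ℤ.+ c in
    x ℤ.+ (v ℤ.+ u) ℤ.+ b ≡ + 2 ℤ.* x ℤ.+ b ℤ.- + 2 ℤ.* c ℤ.- d
  solved = ℤ-Ring.solve-∀

  eliminate : ∀ {y} x b c d u v → y ≡ x ℤ.+ (v ℤ.+ u) ℤ.+ b → x ≡ b ℤ.+ v ℤ.+ c → b ≡ c ℤ.+ u ℤ.+ d →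
    y ≡ + 2 ℤ.* x ℤ.+ b ℤ.- + 2 ℤ.* c ℤ.- d
  eliminate _ _ c d u v refl refl refl = solved c u d v

Recurrence₄-unique : ∀ (u v : Series) → Recurrence₄ u → Recurrence₄ v →
  u 0 ≡ v 0 → u 1 ≡ v 1 → u 2 ≡ v 2 → u 3 ≡ v 3 → u ≗ v
Recurrence₄-unique u v ru rv e₀ e₁ e₂ e₃ zero    = e₀
Recurrence₄-unique u v ru rv e₀ e₁ e₂ e₃ (suc n) =
  Recurrence₄-unique (λ k → u (suc k)) (λ k → v (suc k)) (λ k → ru (suc k)) (λ k → rv (suc k)) e₁ e₂ e₃ e₄ n
  where
  e₄ : u 4 ≡ v 4
  e₄ rewrite ru 0 | rv 0 | e₀ | e₁ | e₂ | e₃ = refl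

ℓ-series : ℓℤ ≗ 𝐪
-- Both sides evaluate to 0, 0, 1, 2, the left one by counting the edges of `𝓕 0` to `𝓕 3`.
ℓ-series = Recurrence₄-unique ℓℤ 𝐪 ℓ-recurrence₄ 𝐪-recurrence₄ refl refl refl refl

-- The closed form

-- The identity Lₙ₊₂ + Lₙ = 5Fₙ₊₁ with Lₙ₊₂ expanded: exactly what converts the term 5|𝓕ₙ| in the
-- induction for the closed form.
L-F : ∀ n → L (suc n) ℕ.+ 2 ℕ.* L n ≡ 5 ℕ.* F (suc n)
L-F zero          = refl
L-F (suc zero)    = refl
L-F (suc (suc n)) = trans (regroup (L (suc n)) (L n))
  (trans (cong₂ ℕ._+_ (L-F (suc n)) (L-F n)) (sym (ℕ.*-distribˡ-+ 5 (F (2 ℕ.+ n)) (F (1 ℕ.+ n)))))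
  where
  regroup : ∀ a b → a ℕ.+ b ℕ.+ a ℕ.+ 2 ℕ.* (a ℕ.+ b) ≡ (a ℕ.+ b ℕ.+ 2 ℕ.* a) ℕ.+ (a ℕ.+ 2 ℕ.* b)
  regroup = ℕ-Ring.solve-∀

-- The closed form without subtraction, so that the induction stays in ℕ.
5ℓ+F≡nL : ∀ n → 5 ℕ.* ℓ (𝓕 n) ℕ.+ F n ≡ n ℕ.* L n
5ℓ+F≡nL zero          = refl
5ℓ+F≡nL (suc zero)    = refl
5ℓ+F≡nL (suc (suc n)) = begin
  5 ℕ.* ℓ (𝓕 (2 ℕ.+ n)) ℕ.+ F (2 ℕ.+ n)
    ≡⟨ cong (λ l → 5 ℕ.* l ℕ.+ F (2 ℕ.+ n)) (ℓ-F n) ⟩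
  5 ℕ.* (ℓ (𝓕 (1 ℕ.+ n)) ℕ.+ F (1 ℕ.+ n) ℕ.+ ℓ (𝓕 n)) ℕ.+ (F (1 ℕ.+ n) ℕ.+ F n)
    ≡⟨ regroup (ℓ (𝓕 (1 ℕ.+ n))) (ℓ (𝓕 n)) (F (1 ℕ.+ n)) (F n) ⟩
  (5 ℕ.* ℓ (𝓕 (1 ℕ.+ n)) ℕ.+ F (1 ℕ.+ n)) ℕ.+ (5 ℕ.* ℓ (𝓕 n) ℕ.+ F n) ℕ.+ 5 ℕ.* F (1 ℕ.+ n)
    ≡⟨ cong₂ ℕ._+_ (cong₂ ℕ._+_ (5ℓ+F≡nL (suc n)) (5ℓ+F≡nL n)) (sym (L-F n)) ⟩
  suc n ℕ.* L (suc n) ℕ.+ n ℕ.* L n ℕ.+ (L (suc n) ℕ.+ 2 ℕ.* L n)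
    ≡⟨ collect n (L (suc n)) (L n) ⟩
  (2 ℕ.+ n) ℕ.* L (2 ℕ.+ n) ∎
  where
  open ≡-Reasoning
  regroup : ∀ x y a b → 5 ℕ.* (x ℕ.+ a ℕ.+ y) ℕ.+ (a ℕ.+ b) ≡ (5 ℕ.* x ℕ.+ a) ℕ.+ (5 ℕ.* y ℕ.+ b) ℕ.+ 5 ℕ.* a
  regroup = ℕ-Ring.solve-∀
  collect : ∀ n a b → (1 ℕ.+ n) ℕ.* a ℕ.+ n ℕ.* b ℕ.+ (a ℕ.+ 2 ℕ.* b) ≡ (2 ℕ.+ n) ℕ.* (a ℕ.+ b)
  collect = ℕ-Ring.solve-∀

5ℓ≡nL-F : ∀ n → + 5 ℤ.* ℓℤ n ≡ + n ℤ.* + L n ℤ.- + F n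
5ℓ≡nL-F n = begin
  + 5 ℤ.* + l                         ≡⟨ add-sub (+ 5 ℤ.* + l) (+ F n) ⟩
  + 5 ℤ.* + l ℤ.+ + F n ℤ.- + F n     ≡⟨ cong (λ a → a ℤ.+ + F n ℤ.- + F n) (ℤ.pos-* 5 l) ⟨
  + (5 ℕ.* l ℕ.+ F n) ℤ.- + F n       ≡⟨ cong (λ a → + a ℤ.- + F n) (5ℓ+F≡nL n) ⟩
  + (n ℕ.* L n) ℤ.- + F n             ≡⟨ cong (ℤ._- + F n) (ℤ.pos-* n (L n)) ⟩
  + n ℤ.* + L n ℤ.- + F n             ∎
  where
  open ≡-Reasoning
  l = ℓ (𝓕 n)
  add-sub : ∀ a b → a ≡ a ℤ.+ b ℤ.- b
  add-sub = ℤ-Ring.solve-∀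

-- Arithmetic in ℚ and irrationality of √5

-- Infinite descent. If m > 0 then 5 divides m = 5j, hence k² = 5j² with k < m; the hypothesis for k
-- gives k = 0, and then m² = 0.
m²≡5k²⇒m≡0 : ∀ m k → m ℕ.* m ≡ 5 ℕ.* (k ℕ.* k) → m ≡ 0
m²≡5k²⇒m≡0 = <-rec _ descend
  where
  descend : ∀ m → (∀ {k} → k ℕ.< m → ∀ j → k ℕ.* k ≡ 5 ℕ.* (j ℕ.* j) → k ≡ 0) →
            ∀ k → m ℕ.* m ≡ 5 ℕ.* (k ℕ.* k) → m ≡ 0
  descend zero    _  k eq = refl
  descend (suc m) ih k eq
    with divides j sm≡j*5 ← reduce (euclidsLemma (suc m) (suc m) (from-yes (prime? 5))
                                     (subst (5 ∣_) (sym eq) (m∣m*n (k ℕ.* k))))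
    = contradiction (trans eq (cong (λ k → 5 ℕ.* (k ℕ.* k)) k≡0)) λ ()
    where
    regroup : ∀ j → (j ℕ.* 5) ℕ.* (j ℕ.* 5) ≡ 5 ℕ.* (5 ℕ.* (j ℕ.* j))
    regroup = ℕ-Ring.solve-∀

    k²≡5j² : k ℕ.* k ≡ 5 ℕ.* (j ℕ.* j)
    k²≡5j² = ℕ.*-cancelˡ-≡ _ _ 5 (trans (sym eq) (trans (cong₂ ℕ._*_ sm≡j*5 sm≡j*5) (regroup j)))

    m≤k⇒m²<5k² : suc m ℕ.≤ k → suc m ℕ.* suc m ℕ.< 5 ℕ.* (k ℕ.* k)
    m≤k⇒m²<5k² m≤k = ℕ.≤-<-trans (ℕ.*-mono-≤ m≤k m≤k)
      (subst (k ℕ.* k ℕ.<_) (ℕ.*-comm (k ℕ.* k) 5)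
        (ℕ.m<m*n (k ℕ.* k) 5 ⦃ ℕ.m*n≢0 k k ⦃ k≢0 ⦄ ⦃ k≢0 ⦄ ⦄ (ℕ.s≤s (ℕ.s≤s ℕ.z≤n))))
      where k≢0 = ℕ.>-nonZero (ℕ.<-≤-trans (ℕ.s≤s ℕ.z≤n) m≤k)

    k≡0 : k ≡ 0
    k≡0 = ih (ℕ.≰⇒> λ m≤k → ℕ.<⇒≢ (m≤k⇒m²<5k² m≤k) eq) j k²≡5j²

module Rational where

  open import Data.Rational.Base using (_+_; _*_; _-_; -_; _<_; _≤_; _/_)

  ℚ-ring : ACR.AlmostCommutativeRing _ _
  ℚ-ring = ACR.fromCommutativeRing ℚ.+-*-commutativeRing λ x → dec⇒maybe (0ℚ ℚ.≟ x)

  ι : ℤ → ℚ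
  ι z = z / 1

  -- Normalisation divides by a gcd, which is stuck on a variable; among unnormalised rationals the
  -- facts below become statements about integers.
  toℚᵘ-ι : ∀ z → toℚᵘ (ι z) ℚᵘ.≃ mkℚᵘ z 0
  toℚᵘ-ι z = ℚ.toℚᵘ-fromℚᵘ (mkℚᵘ z 0)

  ι≡/ : ∀ {y z} d → + suc d ℤ.* y ≡ z → ι y ≡ z / suc d
  ι≡/ {y} d refl = ℚ.fromℚᵘ-cong {mkℚᵘ y 0} {mkℚᵘ (+ suc d ℤ.* y) d} (*≡* (commute y (+ suc d)))
    where
    commute : ∀ y e → y ℤ.* e ≡ e ℤ.* y ℤ.* 1ℤ
    commute = ℤ-Ring.solve-∀

  ι-+ : ∀ y z → ι (y ℤ.+ z) ≡ ι y + ι z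
  ι-+ y z = ℚ.toℚᵘ-injective (begin
    toℚᵘ (ι (y ℤ.+ z))               ≈⟨ toℚᵘ-ι (y ℤ.+ z) ⟩
    mkℚᵘ (y ℤ.+ z) 0                 ≈⟨ *≡* (unfold y z) ⟩
    mkℚᵘ y 0 ℚᵘ.+ mkℚᵘ z 0           ≈⟨ ℚᵘ.+-cong (toℚᵘ-ι y) (toℚᵘ-ι z) ⟨
    toℚᵘ (ι y) ℚᵘ.+ toℚᵘ (ι z)       ≈⟨ ℚ.toℚᵘ-homo-+ (ι y) (ι z) ⟨
    toℚᵘ (ι y + ι z)                 ∎)
    where
    open ℚᵘ.≃-Reasoning
    unfold : ∀ y z → (y ℤ.+ z) ℤ.* 1ℤ ≡ (y ℤ.* 1ℤ ℤ.+ z ℤ.* 1ℤ) ℤ.* 1ℤ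
    unfold = ℤ-Ring.solve-∀

  ι-* : ∀ y z → ι (y ℤ.* z) ≡ ι y * ι z
  ι-* y z = ℚ.toℚᵘ-injective (begin
    toℚᵘ (ι (y ℤ.* z))               ≈⟨ toℚᵘ-ι (y ℤ.* z) ⟩
    mkℚᵘ y 0 ℚᵘ.* mkℚᵘ z 0           ≈⟨ ℚᵘ.*-cong (toℚᵘ-ι y) (toℚᵘ-ι z) ⟨
    toℚᵘ (ι y) ℚᵘ.* toℚᵘ (ι z)       ≈⟨ ℚ.toℚᵘ-homo-* (ι y) (ι z) ⟨
    toℚᵘ (ι y * ι z)                 ∎)
    where open ℚᵘ.≃-Reasoning

  ι-mono-≤ : ∀ {y z} → y ℤ.≤ z → ι y ≤ ι z
  ι-mono-≤ {y} {z} y≤z = ℚ.toℚᵘ-cancel-≤ (ℚᵘ.≤-respˡ-≃ (ℚᵘ.≃-sym (toℚᵘ-ι y)) (ℚᵘ.≤-respʳ-≃ (ℚᵘ.≃-sym (toℚᵘ-ι z))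
    (ℚᵘ.*≤* (ℤ.*-monoʳ-≤-nonNeg 1ℤ y≤z))))

  /-*-cancel : ∀ z d .{{_ : ℕ.NonZero d}} → (z / d) * ι (+ d) ≡ ι z
  /-*-cancel z (suc d) = ℚ.toℚᵘ-injective (begin
    toℚᵘ ((z / suc d) * ι (+ suc d))              ≈⟨ ℚ.toℚᵘ-homo-* (z / suc d) (ι (+ suc d)) ⟩
    toℚᵘ (z / suc d) ℚᵘ.* toℚᵘ (ι (+ suc d))      ≈⟨ ℚᵘ.*-cong (ℚ.toℚᵘ-fromℚᵘ (mkℚᵘ z d)) (toℚᵘ-ι (+ suc d)) ⟩
    mkℚᵘ z d ℚᵘ.* mkℚᵘ (+ suc d) 0                ≈⟨ *≡* (reassoc z (+ suc d)) ⟩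
    mkℚᵘ z 0                                      ≈⟨ toℚᵘ-ι z ⟨
    toℚᵘ (ι z)                                    ∎)
    where
    open ℚᵘ.≃-Reasoning
    reassoc : ∀ y e → y ℤ.* e ℤ.* 1ℤ ≡ y ℤ.* (e ℤ.* 1ℤ)
    reassoc = ℤ-Ring.solve-∀

  archimedean : ∀ x → ∃[ N ] ∀ n → N ℕ.≤ n → x < ι (+ n)
  -- For x = p / (d + 1) the bound |p| + 1 works, since the denominator is at least 1.
  archimedean x@(mkℚ p d _) = suc ℤ.∣ p ∣ , λ n N≤n →
    ℚ.toℚᵘ-cancel-< (ℚᵘ.<-respʳ-≃ (ℚᵘ.≃-sym (toℚᵘ-ι (+ n))) (ℚᵘ.*<* (begin-strict
      p ℤ.* 1ℤ            ≡⟨ ℤ.*-identityʳ p ⟩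
      p                   ≤⟨ ≤∣∣ p ⟩
      + ℤ.∣ p ∣           <⟨ ℤ.+<+ N≤n ⟩
      + n                 ≤⟨ ℤ.+≤+ (ℕ.m≤m*n n (suc d)) ⟩
      + (n ℕ.* suc d)     ≡⟨ ℤ.pos-* n (suc d) ⟩
      + n ℤ.* + suc d     ∎)))
    where
    open ℤ.≤-Reasoning
    ≤∣∣ : ∀ p → p ℤ.≤ + ℤ.∣ p ∣
    ≤∣∣ (+ n)      = ℤ.≤-refl
    ≤∣∣ (ℤ.-[1+ n ]) = ℤ.-≤+

  -- Clearing the denominators of a = p/d′ and b = q/e′ gives |pe′|² = 5|qd′|², to which the descent
  -- in ℕ applies.
  √5-irrational : ∀ a b → a * a ≡ + 5 / 1 * (b * b) → b ≡ 0ℚ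
  √5-irrational a@(mkℚ p d _) b@(mkℚ q e _) eq = ℚ.↥p≡0⇒p≡0 b (q≡0 (ℤ.i*j≡0⇒i≡0∨j≡0 q qd≡0))
    where
    open ≡-Reasoning
    d′ = + suc d
    e′ = + suc e

    squares : mkℚᵘ p d ℚᵘ.* mkℚᵘ p d ℚᵘ.≃ mkℚᵘ (+ 5) 0 ℚᵘ.* (mkℚᵘ q e ℚᵘ.* mkℚᵘ q e)
    squares = ℚᵘ.≃-trans (ℚᵘ.≃-sym (ℚ.toℚᵘ-homo-* a a)) (ℚᵘ.≃-trans (ℚᵘ.≃-reflexive (cong toℚᵘ eq))
      (ℚᵘ.≃-trans (ℚ.toℚᵘ-homo-* (+ 5 / 1) (b * b)) (ℚᵘ.*-cong ℚᵘ.≃-refl (ℚ.toℚᵘ-homo-* b b))))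

    clear : ∀ p q d e → p ℤ.* p ℤ.* (1ℤ ℤ.* (e ℤ.* e)) ≡ + 5 ℤ.* (q ℤ.* q) ℤ.* (d ℤ.* d) →
            (p ℤ.* e) ℤ.* (p ℤ.* e) ≡ + 5 ℤ.* ((q ℤ.* d) ℤ.* (q ℤ.* d))
    clear p q d e eq = trans (left p e) (trans eq (right q d))
      where
      left : ∀ p e → (p ℤ.* e) ℤ.* (p ℤ.* e) ≡ p ℤ.* p ℤ.* (1ℤ ℤ.* (e ℤ.* e))
      left = ℤ-Ring.solve-∀
      right : ∀ q d → + 5 ℤ.* (q ℤ.* q) ℤ.* (d ℤ.* d) ≡ + 5 ℤ.* ((q ℤ.* d) ℤ.* (q ℤ.* d))
      right = ℤ-Ring.solve-∀

    ∣pe∣²≡5∣qd∣² : ℤ.∣ p ℤ.* e′ ∣ ℕ.* ℤ.∣ p ℤ.* e′ ∣ ≡ 5 ℕ.* (ℤ.∣ q ℤ.* d′ ∣ ℕ.* ℤ.∣ q ℤ.* d′ ∣)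
    ∣pe∣²≡5∣qd∣² = begin
      ℤ.∣ p ℤ.* e′ ∣ ℕ.* ℤ.∣ p ℤ.* e′ ∣
        ≡⟨ ℤ.abs-* (p ℤ.* e′) (p ℤ.* e′) ⟨
      ℤ.∣ (p ℤ.* e′) ℤ.* (p ℤ.* e′) ∣
        ≡⟨ cong ℤ.∣_∣ (clear p q d′ e′ (ℚᵘ.drop-*≡* squares)) ⟩
      ℤ.∣ + 5 ℤ.* ((q ℤ.* d′) ℤ.* (q ℤ.* d′)) ∣
        ≡⟨ ℤ.abs-* (+ 5) ((q ℤ.* d′) ℤ.* (q ℤ.* d′)) ⟩
      5 ℕ.* ℤ.∣ (q ℤ.* d′) ℤ.* (q ℤ.* d′) ∣
        ≡⟨ cong (5 ℕ.*_) (ℤ.abs-* (q ℤ.* d′) (q ℤ.* d′)) ⟩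
      5 ℕ.* (ℤ.∣ q ℤ.* d′ ∣ ℕ.* ℤ.∣ q ℤ.* d′ ∣) ∎

    ∣qd∣²≡0 : ℤ.∣ q ℤ.* d′ ∣ ℕ.* ℤ.∣ q ℤ.* d′ ∣ ≡ 0
    ∣qd∣²≡0 = ℕ.*-cancelˡ-≡ _ 0 5 (trans (sym ∣pe∣²≡5∣qd∣²)
      (cong (λ m → m ℕ.* m) (m²≡5k²⇒m≡0 ℤ.∣ p ℤ.* e′ ∣ ℤ.∣ q ℤ.* d′ ∣ ∣pe∣²≡5∣qd∣²)))

    qd≡0 : q ℤ.* d′ ≡ 0ℤ
    qd≡0 = ℤ.∣i∣≡0⇒i≡0 (reduce (ℕ.m*n≡0⇒m≡0∨n≡0 ℤ.∣ q ℤ.* d′ ∣ ∣qd∣²≡0))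

    q≡0 : q ≡ 0ℤ ⊎ d′ ≡ 0ℤ → q ≡ 0ℤ
    q≡0 (inj₁ eq) = eq

-- Inequalities behind the asymptotics

module Inequalities where

  open import Data.Rational.Base using (_+_; _*_; _-_; -_; _<_; _≤_; _/_)
  open Rational

  infixl 6 _⊕_ _⊕⁺_
  infixl 7 _⊗_ _⊗⁺_

  _⊕_ : ∀ {a b} → 0ℚ ≤ a → 0ℚ ≤ b → 0ℚ ≤ a + b
  _⊕_ = ℚ.+-mono-≤

  _⊕⁺_ : ∀ {a b} → 0ℚ ≤ a → 0ℚ < b → 0ℚ < a + b
  _⊕⁺_ = ℚ.+-mono-≤-<

  _⊗_ : ∀ {a b} → 0ℚ ≤ a → 0ℚ ≤ b → 0ℚ ≤ a * b
  _⊗_ {a} {b} 0≤a 0≤b =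
    ℚ.nonNegative⁻¹ (a * b) ⦃ ℚ.nonNeg*nonNeg⇒nonNeg a ⦃ ℚ.nonNegative 0≤a ⦄ b ⦃ ℚ.nonNegative 0≤b ⦄ ⦄

  _⊗⁺_ : ∀ {a b} → 0ℚ < a → 0ℚ < b → 0ℚ < a * b
  _⊗⁺_ {a} {b} 0<a 0<b = ℚ.positive⁻¹ (a * b) ⦃ ℚ.pos*pos⇒pos a ⦃ ℚ.positive 0<a ⦄ b ⦃ ℚ.positive 0<b ⦄ ⦄

  ≤⇒0≤- : ∀ {a b} → a ≤ b → 0ℚ ≤ b - a
  ≤⇒0≤- {a} {b} a≤b = subst (_≤ b - a) (ℚ.+-inverseʳ a) (ℚ.+-monoˡ-≤ (- a) a≤b)

  <⇒0<- : ∀ {a b} → a < b → 0ℚ < b - a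
  <⇒0<- {a} {b} a<b = subst (_< b - a) (ℚ.+-inverseʳ a) (ℚ.+-monoˡ-< (- a) a<b)

  -- Turns a certificate into an inequality: `c` is the explicit gap, its sign one argument and the
  -- identity the other.
  ≡+⇒≤ : ∀ {a b c} → 0ℚ ≤ c → b ≡ a + c → a ≤ b
  ≡+⇒≤ {a} {b} 0≤c refl = subst (_≤ b) (ℚ.+-identityʳ a) (ℚ.+-monoʳ-≤ a 0≤c)

  ≡+⇒< : ∀ {a b c} → 0ℚ < c → b ≡ a + c → a < b
  ≡+⇒< {a} {b} 0<c refl = subst (_< b) (ℚ.+-identityʳ a) (ℚ.+-monoʳ-< a 0<c)

  -- Reduces an identity modulo the hypothesis x ≡ y to a ring identity, d being the cofactor of x - y.
  ≡+mod : ∀ {x y} d {p q} → x ≡ y → p ≡ q + d * (x - y) → p ≡ q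
  ≡+mod {x} d {p} {q} refl refl = vanish d q x
    where
    vanish : ∀ d q x → q + d * (x - x) ≡ q
    vanish = solve-∀ ℚ-ring

  0≤² : ∀ a → 0ℚ ≤ a * a
  0≤² a with ℚ.≤-total 0ℚ a
  ... | inj₁ 0≤a = 0≤a ⊗ 0≤a
  ... | inj₂ a≤0 = subst (0ℚ ≤_) (neg-square a) (ℚ.neg-antimono-≤ a≤0 ⊗ ℚ.neg-antimono-≤ a≤0)
    where
    neg-square : ∀ a → - a * - a ≡ a * a
    neg-square = solve-∀ ℚ-ring

  0≤const : ∀ m n .{{_ : ℕ.NonZero n}} → 0ℚ ≤ + m / n
  0≤const m n = ℚ.nonNegative⁻¹ (+ m / n) ⦃ ℚ.normalize-nonNeg m n ⦄

  0<const : ∀ m n .{{_ : ℕ.NonZero n}} .{{_ : ℕ.NonZero m}} → 0ℚ < + m / n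
  0<const m n = ℚ.positive⁻¹ (+ m / n) ⦃ ℚ.normalize-pos m n ⦄

  -- For a ≥ 0 only a² = 5b² could prevent positivity, and √5 is irrational.
  0<b⇒Positive : ∀ {a b} → 0ℚ < b → (a < 0ℚ → a * a < + 5 / 1 * (b * b)) → Positive (_+_√5 a b)
  0<b⇒Positive {a} {b} 0<b small with ℚ.<-cmp (a * a) (+ 5 / 1 * (b * b)) | ℚ.<-cmp a 0ℚ
  ... | tri< a²<5b² _ _ | _           = inj₂ (0<b , a²<5b²)
  ... | tri≈ _ a²≡5b² _ | _           = contradiction (sym (√5-irrational a b a²≡5b²)) (ℚ.<⇒≢ 0<b)
  ... | tri> a²≮5b² _ _ | tri< a<0 _ _ = contradiction (small a<0) a²≮5b²
  ... | tri> _ _ 5b²<a² | tri> _ _ 0<a = inj₁ (0<a , 5b²<a²)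
  ... | tri> _ _ 5b²<0  | tri≈ _ refl _ = contradiction
    (ℚ.≤-<-trans (0≤const 5 1 ⊗ (ℚ.<⇒≤ 0<b ⊗ ℚ.<⇒≤ 0<b)) 5b²<0) (ℚ.<-irrefl refl)

  -- Allows positive denominators such as 2n to be dropped before squares are compared.
  Positive-scale : ∀ {a b c} → 0ℚ < c → Positive (_+_√5 a b) → Positive (_+_√5 (c * a) (c * b))
  Positive-scale {a} {b} {c} 0<c = λ
    { (inj₁ (0<a , 5b²<a²)) → inj₁ (0<c ⊗⁺ 0<a , ≡+⇒< (0<c ⊗⁺ 0<c ⊗⁺ <⇒0<- 5b²<a²) (scale₁ a b c))
    ; (inj₂ (0<b , a²<5b²)) → inj₂ (0<c ⊗⁺ 0<b , ≡+⇒< (0<c ⊗⁺ 0<c ⊗⁺ <⇒0<- a²<5b²) (scale₂ a b c)) }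
    where
    scale₁ : ∀ a b c → c * a * (c * a) ≡ + 5 / 1 * (c * b * (c * b)) + c * c * (a * a - + 5 / 1 * (b * b))
    scale₁ = solve-∀ ℚ-ring
    scale₂ : ∀ a b c → + 5 / 1 * (c * b * (c * b)) ≡ c * a * (c * a) + c * c * (+ 5 / 1 * (b * b) - a * a)
    scale₂ = solve-∀ ℚ-ring

  0≤1-±1 : ∀ {σ} → σ ≡ 1ℚ ⊎ σ ≡ - 1ℚ → 0ℚ ≤ 1ℚ - σ
  0≤1-±1 (inj₁ refl) = ℚ.≤-refl
  0≤1-±1 (inj₂ refl) = 0≤const 2 1

  0≤1+±1 : ∀ {σ} → σ ≡ 1ℚ ⊎ σ ≡ - 1ℚ → 0ℚ ≤ 1ℚ + σ
  0≤1+±1 (inj₁ refl) = 0≤const 2 1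
  0≤1+±1 (inj₂ refl) = ℚ.≤-refl

  -- In the application σ is (-1)ⁿ, the norm of φⁿ.
  Cassini : ℚ → ℚ → ℚ → Set
  Cassini L F σ = (σ ≡ 1ℚ ⊎ σ ≡ - 1ℚ) × L * L ≡ + 5 / 1 * (F * F) + + 4 / 1 * σ

  module _
    {n L F ε : ℚ}
    (0<ε : 0ℚ < ε)
    (2≤εn : + 2 / 1 ≤ ε * n)
    (2⟨1+ε⟩²<n : + 2 / 1 * ((1ℚ + ε) * (1ℚ + ε)) < n)
    (1≤F : 1ℚ ≤ F)
    (F≤L : F ≤ L)
    (n≤L : n ≤ L)
    where

    0≤ε : 0ℚ ≤ ε
    0≤ε = ℚ.<⇒≤ 0<ε

    0<n : 0ℚ < n
    0<n = ℚ.≤-<-trans (0≤const 2 1 ⊗ ((0≤const 1 1 ⊕ 0≤ε) ⊗ (0≤const 1 1 ⊕ 0≤ε))) 2⟨1+ε⟩²<n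

    0≤n : 0ℚ ≤ n
    0≤n = ℚ.<⇒≤ 0<n

    0<F : 0ℚ < F
    0<F = ℚ.<-≤-trans (0<const 1 1) 1≤F

    0≤F : 0ℚ ≤ F
    0≤F = ℚ.<⇒≤ 0<F

    0<L : 0ℚ < L
    0<L = ℚ.<-≤-trans 0<F F≤L

    0≤L : 0ℚ ≤ L
    0≤L = ℚ.<⇒≤ 0<L

    2≤n : + 2 / 1 ≤ n
    2≤n = ≡+⇒≤ (<⇒≤′ ⊕ (0≤const 4 1 ⊗ 0≤ε ⊕ 0≤const 2 1 ⊗ (0≤ε ⊗ 0≤ε))) (expand n ε)
      where
      <⇒≤′ = ≤⇒0≤- (ℚ.<⇒≤ 2⟨1+ε⟩²<n)
      expand : ∀ n ε → n ≡ + 2 / 1 + ((n - + 2 / 1 * ((1ℚ + ε) * (1ℚ + ε))) + (+ 4 / 1 * ε + + 2 / 1 * (ε * ε)))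
      expand = solve-∀ ℚ-ring

    -- In the application this is 5ℓ, by the closed form.
    M : ℚ
    M = n * L - F

    ½nL≤M : ½ * n * L ≤ M
    ½nL≤M = ≡+⇒≤ (0≤const 1 2 ⊗ ≤⇒0≤- 2≤n ⊗ 0≤L ⊕ ≤⇒0≤- F≤L) (expand n L F)
      where
      expand : ∀ n L F → n * L - F ≡ ½ * n * L + (½ * (n - + 2 / 1) * L + (L - F))
      expand = solve-∀ ℚ-ring

    0<½nL : 0ℚ < ½ * n * L
    0<½nL = 0<const 1 2 ⊗⁺ 0<n ⊗⁺ 0<L

    0<M : 0ℚ < M
    0<M = ℚ.<-≤-trans 0<½nL ½nL≤M

    0≤M : 0ℚ ≤ M
    0≤M = ℚ.<⇒≤ 0<M

    L≤εnL-F : L ≤ ε * n * L - F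
    L≤εnL-F = ≡+⇒≤ (≤⇒0≤- 2≤εn ⊗ 0≤L ⊕ ≤⇒0≤- F≤L) (expand n L F ε)
      where
      expand : ∀ n L F ε → ε * n * L - F ≡ L + ((ε * n - + 2 / 1) * L + (L - F))
      expand = solve-∀ ℚ-ring

    -- The source of both thresholds on n: 2 ≤ εn gives εnL - F ≥ L, and n ≥ 2 gives M ≥ nL/2, so
    -- the product is at least nL²/2 ≥ n³/2, which exceeds (1+ε)²n² once n > 2(1+ε)².
    ⟨1+ε⟩²n²<M⟨εnL-F⟩ : (1ℚ + ε) * n * ((1ℚ + ε) * n) < M * (ε * n * L - F)
    ⟨1+ε⟩²n²<M⟨εnL-F⟩ = ≡+⇒<
      ((≤⇒0≤- ½nL≤M ⊗ (≤⇒0≤- L≤εnL-F ⊕ 0≤L) ⊕ ℚ.<⇒≤ 0<½nL ⊗ ≤⇒0≤- L≤εnL-F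
         ⊕ 0≤const 1 2 ⊗ 0≤n ⊗ (≤⇒0≤- n≤L ⊗ (0≤L ⊕ 0≤n)))
       ⊕⁺ (0<const 1 2 ⊗⁺ <⇒0<- 2⟨1+ε⟩²<n ⊗⁺ (0<n ⊗⁺ 0<n)))
      (expand n L M (ε * n * L - F) ε)
      where
      expand : ∀ n L M K ε → M * K ≡ (1ℚ + ε) * n * ((1ℚ + ε) * n) +
        (((M - ½ * n * L) * ((K - L) + L) + ½ * n * L * (K - L) + ½ * n * ((L - n) * (L + n)))
         + ½ * (n - + 2 / 1 * ((1ℚ + ε) * (1ℚ + ε))) * (n * n))
      expand = solve-∀ ℚ-ring

    ⟨1-ε⟩²n²<M⟨εnL-F⟩ : (1ℚ - ε) * n * ((1ℚ - ε) * n) < M * (ε * n * L - F)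
    ⟨1-ε⟩²n²<M⟨εnL-F⟩ = ℚ.≤-<-trans (≡+⇒≤ (0≤const 4 1 ⊗ 0≤ε ⊗ (0≤n ⊗ 0≤n)) (expand n ε)) ⟨1+ε⟩²n²<M⟨εnL-F⟩
      where
      expand : ∀ n ε → (1ℚ + ε) * n * ((1ℚ + ε) * n) ≡ (1ℚ - ε) * n * ((1ℚ - ε) * n) + + 4 / 1 * ε * (n * n)
      expand = solve-∀ ℚ-ring

    ⟨1+ε⟩²n²<M⟨εnL+F⟩ : (1ℚ + ε) * n * ((1ℚ + ε) * n) < M * (ε * n * L + F)
    ⟨1+ε⟩²n²<M⟨εnL+F⟩ = ℚ.<-≤-trans ⟨1+ε⟩²n²<M⟨εnL-F⟩ (≡+⇒≤ (0≤const 2 1 ⊗ (0≤M ⊗ 0≤F)) (expand n L M F ε))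
      where
      expand : ∀ n L M F ε → M * (ε * n * L + F) ≡ M * (ε * n * L - F) + + 2 / 1 * (M * F)
      expand = solve-∀ ℚ-ring

    -- Makes the rational part in `ratio₁-lower` positive when σ = 1; the chain is ML ≥ nL²/2 ≥ n³/2
    -- ≥ 2n.
    2⟨1-ε⟩n<ML : + 2 / 1 * (1ℚ - ε) * n < M * L
    2⟨1-ε⟩n<ML = ≡+⇒<
      (≤⇒0≤- ½nL≤M ⊗ 0≤L ⊕ 0≤const 1 2 ⊗ 0≤n ⊗ (≤⇒0≤- n≤L ⊗ (0≤L ⊕ 0≤n))
        ⊕ 0≤const 1 2 ⊗ 0≤n ⊗ (≤⇒0≤- 2≤n ⊗ (0≤n ⊕ 0≤const 2 1))
        ⊕⁺ (0<const 2 1 ⊗⁺ 0<ε ⊗⁺ 0<n))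
      (expand n L M ε)
      where
      expand : ∀ n L M ε → M * L ≡ + 2 / 1 * (1ℚ - ε) * n +
        ((M - ½ * n * L) * L + ½ * n * ((L - n) * (L + n)) + ½ * n * ((n - + 2 / 1) * (n + + 2 / 1)) + + 2 / 1 * ε * n)
      expand = solve-∀ ℚ-ring

    0<εnL-F : 0ℚ < ε * n * L - F
    0<εnL-F = ℚ.<-≤-trans 0<L L≤εnL-F

    0<εnL+F : 0ℚ < ε * n * L + F
    0<εnL+F = 0≤ε ⊗ 0≤n ⊗ 0≤L ⊕⁺ 0<F

    0<4 : 0ℚ < + 4 / 1
    0<4 = 0<const 4 1

    -- With L = φⁿ + ψⁿ, √5 F = φⁿ - ψⁿ and 5ℓ = M, the numbers below are 2n (ℓ / (n φⁿ / 5) - (1 - ε)) and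
    -- 2n (1 + ε - ℓ / (n φⁿ / 5)), because 1 / φⁿ = σ (L - F√5) / 2.
    ratio₁-lower : ∀ {σ} → Cassini L F σ → Positive (_+_√5 (σ * (M * L) - + 2 / 1 * (1ℚ - ε) * n) (- (σ * (M * F))))
    ratio₁-lower (inj₁ refl , L²≡5F²+4σ) = inj₁
      ( ≡+⇒< (<⇒0<- 2⟨1-ε⟩n<ML) (simplify (M * L) (+ 2 / 1 * (1ℚ - ε) * n))
      -- In a² - 5b² the term M²(L² - 5F²) collapses to 4M², and the mixed term combines with it
      -- through M - (1-ε)nL = εnL - F. The case σ = -1 differs only in signs.
      , ≡+⇒< (0<4 ⊗⁺ (0≤² ((1ℚ - ε) * n) ⊕⁺ (0<M ⊗⁺ 0<εnL-F)))
             (≡+mod (M * M) L²≡5F²+4σ (expand n L F ε)))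
      where
      simplify : ∀ x y → 1ℚ * x - y ≡ 0ℚ + (x - y)
      simplify = solve-∀ ℚ-ring
      expand : ∀ n L F ε → let M = n * L - F; a = 1ℚ * (M * L) - + 2 / 1 * (1ℚ - ε) * n; b = - (1ℚ * (M * F)) in
        a * a ≡ + 5 / 1 * (b * b) + + 4 / 1 * ((1ℚ - ε) * n * ((1ℚ - ε) * n) + M * (ε * n * L - F))
          + M * M * (L * L - (+ 5 / 1 * (F * F) + + 4 / 1 * 1ℚ))
      expand = solve-∀ ℚ-ring
    ratio₁-lower (inj₂ refl , L²≡5F²+4σ) = inj₂
      ( ≡+⇒< (0<M ⊗⁺ 0<F) (simplify (M * F))
      , ≡+⇒< (0<4 ⊗⁺ <⇒0<- ⟨1-ε⟩²n²<M⟨εnL-F⟩)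
             (≡+mod (- (M * M)) L²≡5F²+4σ (expand n L F ε)))
      where
      simplify : ∀ x → - (- 1ℚ * x) ≡ 0ℚ + x
      simplify = solve-∀ ℚ-ring
      expand : ∀ n L F ε → let M = n * L - F; a = - 1ℚ * (M * L) - + 2 / 1 * (1ℚ - ε) * n; b = - (- 1ℚ * (M * F)) in
        + 5 / 1 * (b * b) ≡ a * a + + 4 / 1 * (M * (ε * n * L - F) - (1ℚ - ε) * n * ((1ℚ - ε) * n))
          + - (M * M) * (L * L - (+ 5 / 1 * (F * F) + + 4 / 1 * - 1ℚ))
      expand = solve-∀ ℚ-ring

    ratio₁-upper : ∀ {σ} → Cassini L F σ → Positive (_+_√5 (+ 2 / 1 * (1ℚ + ε) * n - σ * (M * L)) (σ * (M * F)))
    ratio₁-upper (inj₁ refl , L²≡5F²+4σ) = inj₂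
      ( ≡+⇒< (0<M ⊗⁺ 0<F) (simplify (M * F))
      -- As for the lower bound, now with (1+ε)nL - M = εnL + F.
      , ≡+⇒< (0<4 ⊗⁺ <⇒0<- ⟨1+ε⟩²n²<M⟨εnL+F⟩)
             (≡+mod (- (M * M)) L²≡5F²+4σ (expand n L F ε)))
      where
      simplify : ∀ x → 1ℚ * x ≡ 0ℚ + x
      simplify = solve-∀ ℚ-ring
      expand : ∀ n L F ε → let M = n * L - F; a = + 2 / 1 * (1ℚ + ε) * n - 1ℚ * (M * L); b = 1ℚ * (M * F) in
        + 5 / 1 * (b * b) ≡ a * a + + 4 / 1 * (M * (ε * n * L + F) - (1ℚ + ε) * n * ((1ℚ + ε) * n))
          + - (M * M) * (L * L - (+ 5 / 1 * (F * F) + + 4 / 1 * 1ℚ))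
      expand = solve-∀ ℚ-ring
    ratio₁-upper (inj₂ refl , L²≡5F²+4σ) = inj₁
      ( ≡+⇒< (0≤const 2 1 ⊗ (0≤const 1 1 ⊕ 0≤ε) ⊗ 0≤n ⊕⁺ (0<M ⊗⁺ 0<L)) (simplify (+ 2 / 1 * (1ℚ + ε) * n) (M * L))
      , ≡+⇒< (0<4 ⊗⁺ (0≤² ((1ℚ + ε) * n) ⊕⁺ (0<M ⊗⁺ 0<εnL+F)))
             (≡+mod (M * M) L²≡5F²+4σ (expand n L F ε)))
      where
      simplify : ∀ x y → x - - 1ℚ * y ≡ 0ℚ + (x + y)
      simplify = solve-∀ ℚ-ring
      expand : ∀ n L F ε → let M = n * L - F; a = + 2 / 1 * (1ℚ + ε) * n - - 1ℚ * (M * L); b = - 1ℚ * (M * F) in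
        a * a ≡ + 5 / 1 * (b * b) + + 4 / 1 * ((1ℚ + ε) * n * ((1ℚ + ε) * n) + M * (ε * n * L + F))
          + M * M * (L * L - (+ 5 / 1 * (F * F) + + 4 / 1 * - 1ℚ))
      expand = solve-∀ ℚ-ring

    0<20n² : 0ℚ < + 20 / 1 * (n * n)
    0<20n² = 0<const 20 1 ⊗⁺ (0<n ⊗⁺ 0<n)

    -- With 2 F₊ = F + L for the successor F₊ of F, the numbers below are 10n F₊ (r - (1 - ε)) and 10n F₊ (1 + ε - r)
    -- for r = (ℓ / F₊) / (n / (√5 φ)).
    ratio₂-lower : ∀ {σ} → Cassini L F σ → Positive (_+_√5 (+ 5 / 1 * M - + 5 / 1 * (1ℚ - ε) * n * (F + L)) M)
    ratio₂-lower {σ} (σ≡±1 , L²≡5F²+4σ) = 0<b⇒Positive 0<M λ a<0 →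
      ≡+⇒<
        -- Here a = -5c with c = nF - (2L + F + t), so 25c² = 25n²F² - 25(2L + F + t)(nF + c). Its
        -- leading term cancels against 5n²L² = 25n²F² + 20σn², and the surplus 40nLF ≥ 40n²
        -- outweighs 20σn² even for σ = -1.
        ( 0≤const 40 1 ⊗ 0≤n ⊗ (0≤L ⊗ ≤⇒0≤- 1≤F ⊕ ≤⇒0≤- n≤L) ⊕ 0≤const 20 1 ⊗ (0≤n ⊗ 0≤n) ⊗ 0≤1+±1 σ≡±1
          ⊕ 0≤const 25 1 ⊗ 0≤n ⊗ (0≤F ⊗ 0≤F) ⊕ 0≤const 25 1 ⊗ 0≤n ⊗ 0≤F ⊗ 0≤t ⊕ 0≤const 5 1 ⊗ (0≤F ⊗ 0≤F)
          ⊕ 0≤const 25 1 ⊗ (0≤const 2 1 ⊗ 0≤L ⊕ 0≤F ⊕ 0≤t) ⊗ 0≤c a<0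
          ⊕⁺ 0<20n²)
        (≡+mod (+ 5 / 1 * (n * n)) L²≡5F²+4σ (expand n L F ε σ))
      where
      0≤t : 0ℚ ≤ (ε * n - + 2 / 1) * (L + F)
      0≤t = ≤⇒0≤- 2≤εn ⊗ (0≤L ⊕ 0≤F)

      0≤c : + 5 / 1 * M - + 5 / 1 * (1ℚ - ε) * n * (F + L) < 0ℚ → 0ℚ ≤ (n + 1ℚ) * F - ε * n * (L + F)
      0≤c a<0 = subst (0ℚ ≤_) (regroup n L F ε) (0≤const 1 5 ⊗ ≤⇒0≤- (ℚ.<⇒≤ a<0))
        where
        regroup : ∀ n L F ε → + 1 / 5 * (0ℚ - (+ 5 / 1 * (n * L - F) - + 5 / 1 * (1ℚ - ε) * n * (F + L))) ≡
                              (n + 1ℚ) * F - ε * n * (L + F)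
        regroup = solve-∀ ℚ-ring

      expand : ∀ n L F ε σ →
        let M = n * L - F
            a = + 5 / 1 * M - + 5 / 1 * (1ℚ - ε) * n * (F + L)
            t = (ε * n - + 2 / 1) * (L + F)
            c = (n + 1ℚ) * F - ε * n * (L + F)
        in + 5 / 1 * (M * M) ≡ a * a +
          ( + 40 / 1 * n * (L * (F - 1ℚ) + (L - n)) + + 20 / 1 * (n * n) * (1ℚ + σ)
          + + 25 / 1 * n * (F * F) + + 25 / 1 * n * F * t + + 5 / 1 * (F * F)
          + + 25 / 1 * (+ 2 / 1 * L + F + t) * c
          + + 20 / 1 * (n * n)) + + 5 / 1 * (n * n) * (L * L - (+ 5 / 1 * (F * F) + + 4 / 1 * σ))
      expand = solve-∀ ℚ-ring

    ratio₂-upper : ∀ {σ} → Cassini L F σ → Positive (_+_√5 (+ 5 / 1 * (1ℚ + ε) * n * (F + L) - + 5 / 1 * M) (- M))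
    ratio₂-upper {σ} (σ≡±1 , L²≡5F²+4σ) = inj₁
      ( ≡+⇒< (0≤const 5 1 ⊗ (0≤n ⊗ 0≤F ⊕ 0≤E) ⊕⁺ (0<const 5 1 ⊗⁺ 0<F)) (regroup n L F ε)
      -- With E = εn(L + F) the rational part is 5(nF + E + F). Again 25n²F² cancels against 5n²L²;
      -- the remaining -20σn² is absorbed by 50nFE, because F ≥ 1 and E ≥ n.
      , ≡+⇒<
        ( 0≤const 50 1 ⊗ 0≤n ⊗ (0≤F ⊗ 0≤F) ⊕ 0≤const 50 1 ⊗ 0≤n ⊗ (≤⇒0≤- 1≤F ⊗ 0≤E) ⊕ 0≤const 50 1 ⊗ 0≤n ⊗ 0≤E-n
          ⊕ 0≤const 10 1 ⊗ (0≤n ⊗ 0≤n) ⊕ 0≤const 20 1 ⊗ (0≤n ⊗ 0≤n) ⊗ 0≤1-±1 σ≡±1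
          ⊕ 0≤const 20 1 ⊗ (0≤F ⊗ 0≤F) ⊕ 0≤const 50 1 ⊗ (0≤F ⊗ 0≤E) ⊕ 0≤const 25 1 ⊗ (0≤E ⊗ 0≤E)
          ⊕ 0≤const 10 1 ⊗ 0≤n ⊗ (0≤L ⊗ 0≤F)
          ⊕⁺ 0<20n²)
        (≡+mod (- (+ 5 / 1 * (n * n))) L²≡5F²+4σ (expand n L F ε σ)))
      where
      0≤E : 0ℚ ≤ ε * n * (L + F)
      0≤E = 0≤ε ⊗ 0≤n ⊗ (0≤L ⊕ 0≤F)

      0≤E-n : 0ℚ ≤ (ε * n - + 2 / 1) * (L + F) + ((L - n) + L + + 2 / 1 * F)
      0≤E-n = ≤⇒0≤- 2≤εn ⊗ (0≤L ⊕ 0≤F) ⊕ (≤⇒0≤- n≤L ⊕ 0≤L ⊕ 0≤const 2 1 ⊗ 0≤F)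

      regroup : ∀ n L F ε → + 5 / 1 * (1ℚ + ε) * n * (F + L) - + 5 / 1 * (n * L - F) ≡
                            0ℚ + (+ 5 / 1 * (n * F + ε * n * (L + F)) + + 5 / 1 * F)
      regroup = solve-∀ ℚ-ring

      expand : ∀ n L F ε σ →
        let M = n * L - F
            a = + 5 / 1 * (1ℚ + ε) * n * (F + L) - + 5 / 1 * M
            E = ε * n * (L + F)
        in a * a ≡ + 5 / 1 * (- M * - M) +
          ( + 50 / 1 * n * (F * F) + + 50 / 1 * n * ((F - 1ℚ) * E)
          + + 50 / 1 * n * ((ε * n - + 2 / 1) * (L + F) + ((L - n) + L + + 2 / 1 * F))
          + + 10 / 1 * (n * n) + + 20 / 1 * (n * n) * (1ℚ - σ)
          + + 20 / 1 * (F * F) + + 50 / 1 * (F * E) + + 25 / 1 * (E * E) + + 10 / 1 * n * (L * F)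
          + + 20 / 1 * (n * n)) + - (+ 5 / 1 * (n * n)) * (L * L - (+ 5 / 1 * (F * F) + + 4 / 1 * σ))
      expand = solve-∀ ℚ-ring

-- Asymptotics

1≤F : ∀ n → 1 ℕ.≤ F (suc n)
1≤F zero    = ℕ.≤-refl
1≤F (suc n) = ℕ.≤-trans (1≤F n) (ℕ.m≤m+n (F (suc n)) (F n))

F≤L : ∀ n → F n ℕ.≤ L n
F≤L zero          = ℕ.z≤n
F≤L (suc zero)    = ℕ.≤-refl
F≤L (suc (suc n)) = ℕ.+-mono-≤ (F≤L (suc n)) (F≤L n)

n≤L : ∀ n → n ℕ.≤ L n
n≤L zero                = ℕ.z≤n
n≤L (suc zero)          = ℕ.≤-refl
n≤L (suc (suc zero))    = ℕ.n≤1+n 2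
n≤L (suc (suc (suc n))) = subst (ℕ._≤ L (3 ℕ.+ n)) (ℕ.+-comm (2 ℕ.+ n) 1)
  (ℕ.+-mono-≤ (n≤L (suc (suc n))) (ℕ.≤-trans (1≤F n) (F≤L (suc n))))

F-suc : ∀ n → F n ℕ.+ L n ≡ 2 ℕ.* F (suc n)
F-suc zero          = refl
F-suc (suc zero)    = refl
F-suc (suc (suc n)) = trans (regroup (F (suc n)) (F n) (L (suc n)) (L n))
  (trans (cong₂ ℕ._+_ (F-suc (suc n)) (F-suc n)) (sym (ℕ.*-distribˡ-+ 2 (F (2 ℕ.+ n)) (F (1 ℕ.+ n)))))
  where
  regroup : ∀ a b c d → a ℕ.+ b ℕ.+ (c ℕ.+ d) ≡ (a ℕ.+ c) ℕ.+ (b ℕ.+ d)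
  regroup = ℕ-Ring.solve-∀

-- Together with `F-suc` this is multiplication of (Lₙ + Fₙ√5)/2 by φ, in coordinates.
L-suc : ∀ n → L n ℕ.+ 5 ℕ.* F n ≡ 2 ℕ.* L (suc n)
L-suc zero          = refl
L-suc (suc zero)    = refl
L-suc (suc (suc n)) = trans (regroup (F (suc n)) (F n) (L (suc n)) (L n))
  (trans (cong₂ ℕ._+_ (L-suc (suc n)) (L-suc n)) (sym (ℕ.*-distribˡ-+ 2 (L (2 ℕ.+ n)) (L (1 ℕ.+ n)))))
  where
  regroup : ∀ a b c d → c ℕ.+ d ℕ.+ 5 ℕ.* (a ℕ.+ b) ≡ (c ℕ.+ 5 ℕ.* a) ℕ.+ (d ℕ.+ 5 ℕ.* b)
  regroup = ℕ-Ring.solve-∀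

module Asymptotics where

  open import Data.Rational.Base using (_+_; _*_; _-_; -_; _<_; _≤_; _/_)
  open Rational
  open Inequalities hiding (M)

  ιₙ Lₙ Fₙ ℓₙ : ℕ → ℚ
  ιₙ n = ι (+ n)
  Lₙ n = ιₙ (L n)
  Fₙ n = ιₙ (F n)
  ℓₙ n = ιₙ (ℓ (𝓕 n))

  ιₙ-+* : ∀ a k b → ιₙ (a ℕ.+ k ℕ.* b) ≡ ιₙ a + ιₙ k * ιₙ b
  ιₙ-+* a k b = trans (ι-+ (+ a) (+ (k ℕ.* b))) (cong (_+_ (ιₙ a)) (trans (cong ι (ℤ.pos-* k b)) (ι-* (+ k) (+ b))))

  ιₙ-2* : ∀ b → ιₙ (2 ℕ.* b) ≡ + 2 / 1 * ιₙ b
  ιₙ-2* b = trans (cong ι (ℤ.pos-* 2 b)) (ι-* (+ 2) (+ b))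

  halve : ∀ {x y} → x ≡ + 2 / 1 * y → y ≡ ½ * x
  halve {y = y} refl = half-double y
    where
    half-double : ∀ y → y ≡ ½ * (+ 2 / 1 * y)
    half-double = solve-∀ ℚ-ring

  Lₙ-suc : ∀ n → Lₙ (suc n) ≡ ½ * (Lₙ n + + 5 / 1 * Fₙ n)
  Lₙ-suc n = halve (trans (sym (ιₙ-+* (L n) 5 (F n))) (trans (cong ιₙ (L-suc n)) (ιₙ-2* (L (suc n)))))

  Fₙ-suc : ∀ n → Fₙ (suc n) ≡ ½ * (Fₙ n + Lₙ n)
  Fₙ-suc n = halve (trans (sym (ι-+ (+ F n) (+ L n))) (trans (cong ιₙ (F-suc n)) (ιₙ-2* (F (suc n)))))

  5ℓₙ : ∀ n → + 5 / 1 * ℓₙ n ≡ ιₙ n * Lₙ n - Fₙ n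
  5ℓₙ n = begin
    + 5 / 1 * ℓₙ n                              ≡⟨ add-sub (+ 5 / 1 * ℓₙ n) (Fₙ n) ⟩
    Fₙ n + + 5 / 1 * ℓₙ n - Fₙ n                ≡⟨ cong (_- Fₙ n) (ιₙ-+* (F n) 5 (ℓ (𝓕 n))) ⟨
    ιₙ (F n ℕ.+ 5 ℕ.* ℓ (𝓕 n)) - Fₙ n           
      ≡⟨ cong (λ k → ιₙ k - Fₙ n) (trans (ℕ.+-comm (F n) _) (5ℓ+F≡nL n)) ⟩
    ιₙ (n ℕ.* L n) - Fₙ n                       ≡⟨ cong (_- Fₙ n) (trans (cong ι (ℤ.pos-* n (L n))) (ι-* (+ n) (+ L n))) ⟩
    ιₙ n * Lₙ n - Fₙ n                          ∎
    where
    open ≡-Reasoning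
    add-sub : ∀ x y → x ≡ y + x - y
    add-sub = solve-∀ ℚ-ring

  -- Powers of φ, their norm, and inversion in ℚ(√5)

  σ : ℕ → ℚ
  σ zero    = 1ℚ
  σ (suc n) = - σ n

  σ≡±1 : ∀ n → σ n ≡ 1ℚ ⊎ σ n ≡ - 1ℚ
  σ≡±1 zero = inj₁ refl
  σ≡±1 (suc n) with σ n | σ≡±1 n
  ... | _ | inj₁ refl = inj₂ refl
  ... | _ | inj₂ refl = inj₁ refl

  σσ≡1 : ∀ n → σ n * σ n ≡ 1ℚ
  σσ≡1 n with σ n | σ≡±1 n
  ... | _ | inj₁ refl = refl
  ... | _ | inj₂ refl = refl

  -- φ has norm -1, so passing from n to n + 1 negates L² - 5F²; hence the cofactor -1.
  L²≡5F²+4σ : ∀ n → Lₙ n * Lₙ n ≡ + 5 / 1 * (Fₙ n * Fₙ n) + + 4 / 1 * σ n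
  L²≡5F²+4σ zero    = refl
  L²≡5F²+4σ (suc n) rewrite Lₙ-suc n | Fₙ-suc n = ≡+mod (- 1ℚ) (L²≡5F²+4σ n) (expand (Lₙ n) (Fₙ n) (σ n))
    where
    expand : ∀ l f s → ½ * (l + + 5 / 1 * f) * (½ * (l + + 5 / 1 * f)) ≡
      + 5 / 1 * (½ * (f + l) * (½ * (f + l))) + + 4 / 1 * - s + - 1ℚ * (l * l - (+ 5 / 1 * (f * f) + + 4 / 1 * s))
    expand = solve-∀ ℚ-ring

  cassini : ∀ n → Cassini (Lₙ n) (Fₙ n) (σ n)
  cassini n = σ≡±1 n , L²≡5F²+4σ n

  φ^n≡ : ∀ n → φ ^₅ n ≡ _+_√5 (½ * Lₙ n) (½ * Fₙ n)
  φ^n≡ zero    = refl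
  φ^n≡ (suc n) rewrite φ^n≡ n | Lₙ-suc n | Fₙ-suc n = cong₂ _+_√5 (real (Lₙ n) (Fₙ n)) (irr (Lₙ n) (Fₙ n))
    where
    real : ∀ l f → ½ * (½ * l) + + 5 / 1 * (½ * (½ * f)) ≡ ½ * (½ * (l + + 5 / 1 * f))
    real = solve-∀ ℚ-ring
    irr : ∀ l f → ½ * (½ * f) + ½ * (½ * l) ≡ ½ * (½ * (f + l))
    irr = solve-∀ ℚ-ring

  recip-unique : ∀ p w → p * w ≡ 1ℚ → recip p ≡ w
  recip-unique p w pw≡1 with p ℚ.≟ 0ℚ
  ... | yes refl = contradiction (trans (sym (ℚ.*-zeroˡ w)) pw≡1) λ ()
  ... | no p≢0  = begin
    1/p                ≡⟨ ℚ.*-identityʳ 1/p ⟨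
    1/p * 1ℚ           ≡⟨ cong (1/p *_) pw≡1 ⟨
    1/p * (p * w)      ≡⟨ ℚ.*-assoc 1/p p w ⟨
    1/p * p * w        ≡⟨ cong (_* w) (ℚ.*-inverseˡ p ⦃ ℚ.≢-nonZero p≢0 ⦄) ⟩
    1ℚ * w             ≡⟨ ℚ.*-identityˡ w ⟩
    w                  ∎
    where
    open ≡-Reasoning
    1/p = (ℚ.1/ p) ⦃ ℚ.≢-nonZero p≢0 ⦄

  -- The inverse `w` of the norm is supplied from outside, so that the zero test in `recip` never
  -- has to be evaluated on variables.
  ⁻¹₅-≡ : ∀ a b w → (a * a - + 5 / 1 * (b * b)) * w ≡ 1ℚ → _+_√5 a b ⁻¹₅ ≡ _+_√5 (a * w) (- b * w)
  ⁻¹₅-≡ a b w eq rewrite recip-unique (a * a - + 5 / 1 * (b * b)) w eq = refl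

  positive-inverse : ∀ {p} → 0ℚ < p → ∃[ r ] 0ℚ < r × p * r ≡ 1ℚ
  positive-inverse {p} 0<p = 1/p , ℚ.positive⁻¹ 1/p ⦃ ℚ.1/pos⇒pos p ⦄ , ℚ.*-inverseʳ p
    where
    instance
      p-positive = ℚ.positive 0<p
      p-nonZero  = ℚ.pos⇒nonZero p
    1/p = ℚ.1/ p

  eventually : ∀ {ε} → 0ℚ < ε → ∃[ N ] ∀ n → N ℕ.≤ n →
    + 2 / 1 ≤ ε * ιₙ n × + 2 / 1 * ((1ℚ + ε) * (1ℚ + ε)) < ιₙ n × 1 ℕ.≤ n
  eventually {ε} 0<ε
    with r , 0<r , εr≡1 ← positive-inverse 0<ε
    with N₁ , large₁ ← archimedean (+ 2 / 1 * r)
       | N₂ , large₂ ← archimedean (+ 2 / 1 * ((1ℚ + ε) * (1ℚ + ε)))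
    -- N₁ lies beyond 2/ε and N₂ beyond 2(1+ε)²; the extra 1 ensures n ≥ 1, hence that n is
    -- invertible and Fₙ ≥ 1.
    = suc (N₁ ℕ.+ N₂) , λ n N≤n →
        ≡+⇒≤ (ℚ.<⇒≤ (0<ε ⊗⁺ <⇒0<- (large₁ n (ℕ.≤-trans (ℕ.m≤m+n N₁ N₂) (ℕ.<⇒≤ N≤n)))))
             (≡+mod (+ 2 / 1) εr≡1 (expand ε r (ιₙ n)))
      , large₂ n (ℕ.≤-trans (ℕ.m≤n+m N₂ N₁) (ℕ.<⇒≤ N≤n))
      , ℕ.≤-trans (ℕ.s≤s ℕ.z≤n) N≤n
    where
    expand : ∀ ε r n → ε * n ≡ + 2 / 1 + ε * (n - + 2 / 1 * r) + + 2 / 1 * (ε * r - 1ℚ)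
    expand = solve-∀ ℚ-ring

  -- The two quotients in coordinates

  module _ (n : ℕ) {r : ℚ} (nr≡1 : ιₙ n * r ≡ 1ℚ) where

    M : ℚ
    M = ιₙ n * Lₙ n - Fₙ n

    ℓ/nφⁿ≡ : fromℕ₅ (ℓ (𝓕 n)) /₅ (fromℕ₅ n /₅ fromℕ₅ 5 *₅ φ ^₅ n) ≡
      _+_√5 (½ * r * (σ n * (M * Lₙ n))) (- (½ * r * (σ n * (M * Fₙ n))))
    ℓ/nφⁿ≡ = begin
      fromℕ₅ (ℓ (𝓕 n)) /₅ (fromℕ₅ n /₅ fromℕ₅ 5 *₅ φ ^₅ n)
        ≡⟨ cong (λ x → fromℕ₅ (ℓ (𝓕 n)) /₅ (fromℕ₅ n /₅ fromℕ₅ 5 *₅ x)) (φ^n≡ n) ⟩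
      fromℕ₅ (ℓ (𝓕 n)) /₅ (fromℕ₅ n /₅ fromℕ₅ 5 *₅ _+_√5 (½ * Lₙ n) (½ * Fₙ n))
        ≡⟨ cong (fromℕ₅ (ℓ (𝓕 n)) /₅_) (cong₂ _+_√5 (real₁ (ιₙ n) (Lₙ n) (Fₙ n)) (irr₁ (ιₙ n) (Lₙ n) (Fₙ n))) ⟩
      fromℕ₅ (ℓ (𝓕 n)) /₅ _+_√5 (+ 1 / 10 * ιₙ n * Lₙ n) (+ 1 / 10 * ιₙ n * Fₙ n)
        ≡⟨ cong (fromℕ₅ (ℓ (𝓕 n)) *₅_) (⁻¹₅-≡ (+ 1 / 10 * ιₙ n * Lₙ n) (+ 1 / 10 * ιₙ n * Fₙ n) w norm) ⟩
      fromℕ₅ (ℓ (𝓕 n)) *₅ _+_√5 (+ 1 / 10 * ιₙ n * Lₙ n * w) (- (+ 1 / 10 * ιₙ n * Fₙ n) * w)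
        ≡⟨ cong₂ _+_√5
             (≡+mod (½ * σ n * r * Lₙ n * M) nr≡1
               (≡+mod (½ * σ n * ιₙ n * r * r * Lₙ n) (5ℓₙ n) (real₂ (ιₙ n) r (σ n) (Lₙ n) (Fₙ n) (ℓₙ n))))
             (≡+mod (- (½ * σ n * r * Fₙ n * M)) nr≡1
               (≡+mod (- (½ * σ n * ιₙ n * r * r * Fₙ n)) (5ℓₙ n) (irr₂ (ιₙ n) r (σ n) (Lₙ n) (Fₙ n) (ℓₙ n)))) ⟩
      _+_√5 (½ * r * (σ n * (M * Lₙ n))) (- (½ * r * (σ n * (M * Fₙ n)))) ∎
      where
      open ≡-Reasoning
      -- The divisor nφⁿ/5 has norm σn²/25, and σ is its own inverse.
      w = + 25 / 1 * σ n * (r * r)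

      real₁ : ∀ n l f → (n * (+ 1 / 5) + + 5 / 1 * (0ℚ * 0ℚ)) * (½ * l) + + 5 / 1 * ((n * 0ℚ + 0ℚ * (+ 1 / 5)) * (½ * f)) ≡
        + 1 / 10 * n * l
      real₁ = solve-∀ ℚ-ring
      irr₁ : ∀ n l f → (n * (+ 1 / 5) + + 5 / 1 * (0ℚ * 0ℚ)) * (½ * f) + (n * 0ℚ + 0ℚ * (+ 1 / 5)) * (½ * l) ≡
        + 1 / 10 * n * f
      irr₁ = solve-∀ ℚ-ring

      norm : ((+ 1 / 10 * ιₙ n * Lₙ n) * (+ 1 / 10 * ιₙ n * Lₙ n)
              - + 5 / 1 * ((+ 1 / 10 * ιₙ n * Fₙ n) * (+ 1 / 10 * ιₙ n * Fₙ n))) * w ≡ 1ℚ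
      norm = ≡+mod (ιₙ n * r + 1ℚ) nr≡1 (≡+mod (ιₙ n * ιₙ n * (r * r)) (σσ≡1 n)
        (≡+mod (+ 1 / 4 * ιₙ n * ιₙ n * r * r * σ n) (L²≡5F²+4σ n) (expand (ιₙ n) r (σ n) (Lₙ n) (Fₙ n))))
        where
        expand : ∀ n r s l f →
          (+ 1 / 10 * n * l * (+ 1 / 10 * n * l) - + 5 / 1 * (+ 1 / 10 * n * f * (+ 1 / 10 * n * f))) * (+ 25 / 1 * s * (r * r)) ≡
          1ℚ + (n * r + 1ℚ) * (n * r - 1ℚ) + n * n * (r * r) * (s * s - 1ℚ)
            + + 1 / 4 * n * n * r * r * s * (l * l - (+ 5 / 1 * (f * f) + + 4 / 1 * s))
        expand = solve-∀ ℚ-ring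

      real₂ : ∀ n r s l f ℓ → let m = n * l - f; w = + 25 / 1 * s * (r * r) in
        ℓ * (+ 1 / 10 * n * l * w) + + 5 / 1 * (0ℚ * (- (+ 1 / 10 * n * f) * w)) ≡
        ½ * r * (s * (m * l)) + ½ * s * r * l * m * (n * r - 1ℚ) + ½ * s * n * r * r * l * (+ 5 / 1 * ℓ - (n * l - f))
      real₂ = solve-∀ ℚ-ring
      irr₂ : ∀ n r s l f ℓ → let m = n * l - f; w = + 25 / 1 * s * (r * r) in
        ℓ * (- (+ 1 / 10 * n * f) * w) + 0ℚ * (+ 1 / 10 * n * l * w) ≡
        - (½ * r * (s * (m * f)))
          + - (½ * s * r * f * m) * (n * r - 1ℚ) + - (½ * s * n * r * r * f) * (+ 5 / 1 * ℓ - (n * l - f))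
      irr₂ = solve-∀ ℚ-ring

    ratio₁-1+ε≡ : ∀ ε → fromℕ₅ (ℓ (𝓕 n)) /₅ (fromℕ₅ n /₅ fromℕ₅ 5 *₅ φ ^₅ n) -₅ (fromℕ₅ 1 -₅ fromℚ ε) ≡
      _+_√5 (½ * r * (σ n * (M * Lₙ n) - + 2 / 1 * (1ℚ - ε) * ιₙ n)) (½ * r * - (σ n * (M * Fₙ n)))
    ratio₁-1+ε≡ ε = trans (cong (_-₅ (fromℕ₅ 1 -₅ fromℚ ε)) ℓ/nφⁿ≡)
      (cong₂ _+_√5 (≡+mod (1ℚ - ε) nr≡1 (real (ιₙ n) r ε (σ n * (M * Lₙ n)))) (irr r (σ n * (M * Fₙ n))))
      where
      real : ∀ n r ε x → ½ * r * x - (1ℚ - ε) ≡ ½ * r * (x - + 2 / 1 * (1ℚ - ε) * n) + (1ℚ - ε) * (n * r - 1ℚ)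
      real = solve-∀ ℚ-ring
      irr : ∀ r x → - (½ * r * x) - (0ℚ - 0ℚ) ≡ ½ * r * - x
      irr = solve-∀ ℚ-ring

    1+ε-ratio₁≡ : ∀ ε → fromℕ₅ 1 +₅ fromℚ ε -₅ fromℕ₅ (ℓ (𝓕 n)) /₅ (fromℕ₅ n /₅ fromℕ₅ 5 *₅ φ ^₅ n) ≡
      _+_√5 (½ * r * (+ 2 / 1 * (1ℚ + ε) * ιₙ n - σ n * (M * Lₙ n))) (½ * r * (σ n * (M * Fₙ n)))
    1+ε-ratio₁≡ ε = trans (cong (fromℕ₅ 1 +₅ fromℚ ε -₅_) ℓ/nφⁿ≡)
      (cong₂ _+_√5 (≡+mod (- (1ℚ + ε)) nr≡1 (real (ιₙ n) r ε (σ n * (M * Lₙ n)))) (irr r (σ n * (M * Fₙ n))))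
      where
      real : ∀ n r ε x → 1ℚ + ε - ½ * r * x ≡ ½ * r * (+ 2 / 1 * (1ℚ + ε) * n - x) + - (1ℚ + ε) * (n * r - 1ℚ)
      real = solve-∀ ℚ-ring
      irr : ∀ r x → 0ℚ + 0ℚ - - (½ * r * x) ≡ ½ * r * x
      irr = solve-∀ ℚ-ring

    iₙ : ℚ
    iₙ = i (𝓕 n) {{∣𝓕∣-nonZero n}}

    iₙ-* : iₙ * Fₙ (suc n) ≡ ℓₙ n
    iₙ-* = trans (cong (λ k → iₙ * ιₙ k) (sym (∣𝓕∣≡F n))) (/-*-cancel (+ ℓ (𝓕 n)) ∣ 𝓕 n ∣ {{∣𝓕∣-nonZero n}})

    module _ {s : ℚ} (Fₙ₊₁s≡1 : Fₙ (suc n) * s ≡ 1ℚ) where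

      ⟨F+L⟩s≡2 : (Fₙ n + Lₙ n) * s ≡ + 2 / 1
      ⟨F+L⟩s≡2 = ≡+mod (+ 2 / 1) (trans (cong (_* s) (sym (Fₙ-suc n))) Fₙ₊₁s≡1) (expand (Fₙ n) (Lₙ n) s)
        where
        expand : ∀ f l s → (f + l) * s ≡ + 2 / 1 + + 2 / 1 * (½ * (f + l) * s - 1ℚ)
        expand = solve-∀ ℚ-ring

      5iₙ≡ : + 5 / 1 * iₙ ≡ s * M
      5iₙ≡ = ≡+mod (- (+ 5 / 1 * iₙ)) Fₙ₊₁s≡1
        (≡+mod (+ 5 / 1 * s) iₙ-* (≡+mod s (5ℓₙ n) (expand iₙ (Fₙ (suc n)) s (ℓₙ n) M)))
        where
        expand : ∀ i g s ℓ m → + 5 / 1 * i ≡ s * m + - (+ 5 / 1 * i) * (g * s - 1ℚ)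
          + + 5 / 1 * s * (i * g - ℓ) + s * (+ 5 / 1 * ℓ - m)
        expand = solve-∀ ℚ-ring

      i√5φ/n≡ : fromℚ iₙ /₅ (fromℕ₅ n /₅ (√5 *₅ φ)) ≡ _+_√5 (½ * r * s * M) (+ 1 / 10 * r * s * M)
      i√5φ/n≡ = begin
        fromℚ iₙ /₅ (fromℕ₅ n /₅ (√5 *₅ φ))
          ≡⟨ cong (fromℚ iₙ /₅_) (cong₂ _+_√5 (real₁ (ιₙ n)) (irr₁ (ιₙ n))) ⟩
        fromℚ iₙ /₅ _+_√5 (½ * ιₙ n) (- (+ 1 / 10) * ιₙ n)
          -- The divisor n/(√5 φ) has norm n²/5, hence the witness 5r².
          ≡⟨ cong (fromℚ iₙ *₅_) (⁻¹₅-≡ (½ * ιₙ n) (- (+ 1 / 10) * ιₙ n) (+ 5 / 1 * (r * r)) norm) ⟩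
        fromℚ iₙ *₅ _+_√5 (½ * ιₙ n * (+ 5 / 1 * (r * r))) (- (- (+ 1 / 10) * ιₙ n) * (+ 5 / 1 * (r * r)))
          ≡⟨ cong₂ _+_√5
               (≡+mod (½ * r * s * M) nr≡1 (≡+mod (½ * ιₙ n * r * r) 5iₙ≡ (real₂ (ιₙ n) r iₙ s M)))
               (≡+mod (+ 1 / 10 * r * s * M) nr≡1 (≡+mod (+ 1 / 10 * ιₙ n * r * r) 5iₙ≡ (irr₂ (ιₙ n) r iₙ s M))) ⟩
        _+_√5 (½ * r * s * M) (+ 1 / 10 * r * s * M) ∎
        where
        open ≡-Reasoning

        -- The closed term `(√5 *₅ φ) ⁻¹₅` evaluates to 1/2 - √5/10.
        real₁ : ∀ n → n * ½ + + 5 / 1 * (0ℚ * (- (+ 1 / 10))) ≡ ½ * n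
        real₁ = solve-∀ ℚ-ring
        irr₁ : ∀ n → n * (- (+ 1 / 10)) + 0ℚ * ½ ≡ - (+ 1 / 10) * n
        irr₁ = solve-∀ ℚ-ring

        norm : (½ * ιₙ n * (½ * ιₙ n) - + 5 / 1 * ((- (+ 1 / 10) * ιₙ n) * (- (+ 1 / 10) * ιₙ n)))
               * (+ 5 / 1 * (r * r)) ≡ 1ℚ
        norm = ≡+mod (ιₙ n * r + 1ℚ) nr≡1 (expand (ιₙ n) r)
          where
          expand : ∀ n r →
            (½ * n * (½ * n) - + 5 / 1 * ((- (+ 1 / 10) * n) * (- (+ 1 / 10) * n))) * (+ 5 / 1 * (r * r)) ≡
            1ℚ + (n * r + 1ℚ) * (n * r - 1ℚ)
          expand = solve-∀ ℚ-ring

        real₂ : ∀ n r i s m →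
          i * (½ * n * (+ 5 / 1 * (r * r))) + + 5 / 1 * (0ℚ * (- (- (+ 1 / 10) * n) * (+ 5 / 1 * (r * r)))) ≡
          ½ * r * s * m + ½ * r * s * m * (n * r - 1ℚ) + ½ * n * r * r * (+ 5 / 1 * i - s * m)
        real₂ = solve-∀ ℚ-ring
        irr₂ : ∀ n r i s m → i * (- (- (+ 1 / 10) * n) * (+ 5 / 1 * (r * r))) + 0ℚ * (½ * n * (+ 5 / 1 * (r * r))) ≡
          + 1 / 10 * r * s * m + + 1 / 10 * r * s * m * (n * r - 1ℚ) + + 1 / 10 * n * r * r * (+ 5 / 1 * i - s * m)
        irr₂ = solve-∀ ℚ-ring

      ratio₂-1+ε≡ : ∀ ε → fromℚ iₙ /₅ (fromℕ₅ n /₅ (√5 *₅ φ)) -₅ (fromℕ₅ 1 -₅ fromℚ ε) ≡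
        _+_√5 (+ 1 / 10 * r * s * (+ 5 / 1 * M - + 5 / 1 * (1ℚ - ε) * ιₙ n * (Fₙ n + Lₙ n))) (+ 1 / 10 * r * s * M)
      ratio₂-1+ε≡ ε = trans (cong (_-₅ (fromℕ₅ 1 -₅ fromℚ ε)) i√5φ/n≡)
        (cong₂ _+_√5
          (≡+mod (1ℚ - ε) nr≡1 (≡+mod (½ * (1ℚ - ε) * ιₙ n * r) ⟨F+L⟩s≡2 (real (ιₙ n) r ε s (Fₙ n) (Lₙ n) M)))
          (irr (+ 1 / 10 * r * s * M)))
        where
        real : ∀ n r ε s f l m →
          ½ * r * s * m - (1ℚ - ε) ≡ + 1 / 10 * r * s * (+ 5 / 1 * m - + 5 / 1 * (1ℚ - ε) * n * (f + l))
          + (1ℚ - ε) * (n * r - 1ℚ) + ½ * (1ℚ - ε) * n * r * ((f + l) * s - + 2 / 1)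
        real = solve-∀ ℚ-ring
        irr : ∀ x → x - (0ℚ - 0ℚ) ≡ x
        irr = solve-∀ ℚ-ring

      1+ε-ratio₂≡ : ∀ ε → fromℕ₅ 1 +₅ fromℚ ε -₅ fromℚ iₙ /₅ (fromℕ₅ n /₅ (√5 *₅ φ)) ≡
        _+_√5 (+ 1 / 10 * r * s * (+ 5 / 1 * (1ℚ + ε) * ιₙ n * (Fₙ n + Lₙ n) - + 5 / 1 * M)) (+ 1 / 10 * r * s * - M)
      1+ε-ratio₂≡ ε = trans (cong (fromℕ₅ 1 +₅ fromℚ ε -₅_) i√5φ/n≡)
        (cong₂ _+_√5
          (≡+mod (- (1ℚ + ε)) nr≡1 (≡+mod (- (½ * (1ℚ + ε) * ιₙ n * r)) ⟨F+L⟩s≡2 (real (ιₙ n) r ε s (Fₙ n) (Lₙ n) M)))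
          (irr r s M))
        where
        real : ∀ n r ε s f l m →
          1ℚ + ε - ½ * r * s * m ≡ + 1 / 10 * r * s * (+ 5 / 1 * (1ℚ + ε) * n * (f + l) - + 5 / 1 * m)
          + - (1ℚ + ε) * (n * r - 1ℚ) + - (½ * (1ℚ + ε) * n * r) * ((f + l) * s - + 2 / 1)
        real = solve-∀ ℚ-ring
        irr : ∀ r s m → 0ℚ + 0ℚ - + 1 / 10 * r * s * m ≡ + 1 / 10 * r * s * - m
        irr = solve-∀ ℚ-ring

  1≤Fₙ : ∀ {n} → 1 ℕ.≤ n → 1ℚ ≤ Fₙ n
  1≤Fₙ {suc n} _ = ι-mono-≤ (ℤ.+≤+ (1≤F n))

  ℓ∼ : (λ n → fromℕ₅ (ℓ (𝓕 n))) ∼ (λ n → fromℕ₅ n /₅ fromℕ₅ 5 *₅ φ ^₅ n)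
  ℓ∼ ε 0<ε = proj₁ (eventually 0<ε) , λ n N≤n →
    let 2≤εn , 2⟨1+ε⟩²<n , 1≤n = proj₂ (eventually 0<ε) n N≤n
        r , 0<r , nr≡1 = positive-inverse (ℚ.<-≤-trans (0<const 1 1) (ι-mono-≤ (ℤ.+≤+ 1≤n)))
        0<½r = 0<const 1 2 ⊗⁺ 0<r
        F≤Lₙ = ι-mono-≤ (ℤ.+≤+ (F≤L n))
        n≤Lₙ = ι-mono-≤ (ℤ.+≤+ (n≤L n))
    in subst Positive (sym (ratio₁-1+ε≡ n nr≡1 ε))
         (Positive-scale 0<½r (ratio₁-lower 0<ε 2≤εn 2⟨1+ε⟩²<n (1≤Fₙ 1≤n) F≤Lₙ n≤Lₙ (cassini n)))
     , subst Positive (sym (1+ε-ratio₁≡ n nr≡1 ε))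
         (Positive-scale 0<½r (ratio₁-upper 0<ε 2≤εn 2⟨1+ε⟩²<n (1≤Fₙ 1≤n) F≤Lₙ n≤Lₙ (cassini n)))

  i∼ : (λ n → fromℚ (i (𝓕 n) {{∣𝓕∣-nonZero n}})) ∼ (λ n → fromℕ₅ n /₅ (√5 *₅ φ))
  i∼ ε 0<ε = proj₁ (eventually 0<ε) , λ n N≤n →
    let 2≤εn , 2⟨1+ε⟩²<n , 1≤n = proj₂ (eventually 0<ε) n N≤n
        r , 0<r , nr≡1 = positive-inverse (ℚ.<-≤-trans (0<const 1 1) (ι-mono-≤ (ℤ.+≤+ 1≤n)))
        s , 0<s , Fs≡1 = positive-inverse (ℚ.<-≤-trans (0<const 1 1) (1≤Fₙ {suc n} (ℕ.s≤s ℕ.z≤n)))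
        0<rs/10 = 0<const 1 10 ⊗⁺ 0<r ⊗⁺ 0<s
        F≤Lₙ = ι-mono-≤ (ℤ.+≤+ (F≤L n))
        n≤Lₙ = ι-mono-≤ (ℤ.+≤+ (n≤L n))
    in subst Positive (sym (ratio₂-1+ε≡ n nr≡1 Fs≡1 ε))
         (Positive-scale 0<rs/10 (ratio₂-lower 0<ε 2≤εn 2⟨1+ε⟩²<n (1≤Fₙ 1≤n) F≤Lₙ n≤Lₙ (cassini n)))
     , subst Positive (sym (1+ε-ratio₂≡ n nr≡1 Fs≡1 ε))
         (Positive-scale 0<rs/10 (ratio₂-upper 0<ε 2≤εn 2⟨1+ε⟩²<n (1≤Fₙ 1≤n) F≤Lₙ n≤Lₙ (cassini n)))

open import Data.Nat.Base using (ℕ)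
open import Data.Integer.Base using (+_; _*_; _-_)
open import Data.Product.Base using (_×_)
open import Data.Rational.Base using (_/_)
open import Relation.Binary.PropositionalEquality using (_≡_; _≗_)

mainTheorem16 : ((λ n → + ℓ (𝓕 n)) ≗ X ^ₛ 2 /ₛ (1ₛ -ₛ X -ₛ X ^ₛ 2) ^ₛ 2)
    × (∀ (n : ℕ) → + ℓ (𝓕 n) / 1 ≡ (+ n * + L n - + F n) / 5)
    × ((λ n → fromℕ₅ (ℓ (𝓕 n))) ∼ (λ n → fromℕ₅ n /₅ fromℕ₅ 5 *₅ φ ^₅ n))
    × ((λ n → fromℚ (i (𝓕 n) {{∣𝓕∣-nonZero n}})) ∼ (λ n → fromℕ₅ n /₅ (√5 *₅ φ)))
mainTheorem16 =
  ℓ-series , (λ n → Rational.ι≡/ {ℓℤ n} {+ n * + L n - + F n} 4 (5ℓ≡nL-F n)) , Asymptotics.ℓ∼ , Asymptotics.i∼
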